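{- Let $p=2$. For $j\ge0$ let $c_j$ be the coefficient of the monomial $X_{10}$ in the polynomial $P_j$, where $10$ denotes the two-letter binary word. Then $c_j=[x^j]\log(1+x/2)$ for all $j\ge 0$. In particular, $$\sum_{j\ge 0}c_j=\log(3/2).$$
   Context: Here $p=2$. Words over $\{0,1\}$ are written $w=w_{\mu-1}\cdots w_0$ with $w_{\mu-1}$ leftmost. For a nonnegative integer $n$ with binary expansion $n=\sum_{i\ge 0}n_i2^i$ (padded with infinitely many zero digits) and a word $w$ of length $\mu$ containing a nonzero digit, $|n|_w=|\{i\ge 0: n_{i+\mu-1}\cdots n_i=w_{\mu-1}\cdots w_0\}|$. For $j,n\ge 0$, $\vartheta_2(j,n)=|\{t\in\{0,\ldots,n\}:\nu_2\binom nt=j\}|$, where $\nu_2(m)$ is the exponent of $2$ in $m$. $W$ is the set of all binary words $w_{\mu-1}\cdots w_0$ with $\mu\ge 2$, $w_{\mu-1}=1$ and $w_0=0$. For each $j\ge0$, $P_j$ denotes the polynomial in the variables $X_w$ ($w\in W$) such that $\vartheta_2(j,n)/\vartheta_2(0,n)=P_j\bigl((|n|_w)_{w\in W}\bigr)$ for all $n\ge 0$; such a polynomial exists and is unique. $[x^j]f(x)$ denotes the coefficient of $x^j$ in the power series $f$. -}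

module Defs where

open import Data.Fin.Base using (Fin; toℕ)
open import Data.Fin.Patterns using (0F; 1F)
import Data.Fin.Properties as Fin
open import Data.Integer.Base as ℤ using (+_; -[1+_]; -1ℤ)
import Data.Integer.Properties as ℤ
import Data.Irrelevant as Irrelevant
open import Data.List.Base
  using (List; []; _∷_; _++_; map; filter; foldr; length; head; last; upTo; downFrom)
open import Data.List.Properties using (≡-dec)
open import Data.List.Relation.Unary.All using (All; all?)
open import Data.Maybe.Base using (just)
open import Data.Nat.Base as ℕ using (ℕ; zero; suc)
open import Data.Nat.Combinatorics using (_C_)
open import Data.Nat.Divisibility using (_∣_; _∣?_)
import Data.Nat.DivMod as ℕ
import Data.Nat.Properties as ℕ
open import Data.Product.Base using (∃-syntax; _×_; _,_; proj₁; proj₂)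
open import Data.Rational.Base
  using (ℚ; mkℚ; 0ℚ; 1ℚ; ½; _+_; _*_; _-_; -_; 1/_; _/_; ∣_∣; _≤_; _<_; *<*; *≤*; toℚᵘ;
         Positive; ↥_; ↧_; ↧ₙ_; positive; nonNegative)
import Data.Rational.Properties as ℚ
open import Data.Rational.Solver using (module +-*-Solver)
open import Data.Refinement using (Refinement-syntax; value)
import Data.Rational.Unnormalised.Base as ℚᵘ
import Data.Rational.Unnormalised.Properties as ℚᵘ
import Data.Refinement as Refinement
open import Data.Sum.Base using (inj₁; inj₂)
open import Relation.Binary.PropositionalEquality
open import Relation.Nullary.Decidable using (Dec; _×-dec_; ¬?)
open import Relation.Nullary.Negation using (¬_)

open import Algebra.Properties.CommutativeMonoid.Sum ℚ.+-0-commutativeMonoid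
  using (sum-syntax; sum⁺-syntax)

-- The head of the list is the leftmost letter w_{μ-1}.
Word : Set
Word = List (Fin 2)

digit : ℕ → ℕ → Fin 2
digit n zero    = n ℕ.mod 2
digit n (suc i) = digit (n ℕ./ 2) i

-- n_{i+μ-1} ⋯ n_i
window : (n i μ : ℕ) → Word
window n i μ = map (λ k → digit n (i ℕ.+ k)) (downFrom μ)

-- Since n < 2ⁿ, all digits of n at positions ≥ n vanish, so a word with a
-- nonzero letter can only occur at positions i < n.
occurrences : ℕ → Word → ℕ
occurrences n w =
  length (filter (λ i → ≡-dec Fin._≟_ (window n i (length w)) w) (upTo n))

InW : Word → Set
InW w = (2 ℕ.≤ length w) × (head w ≡ just 1F) × (last w ≡ just 0F)

W : Set
W = [ w ∈ Word ∣ InW w ]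

word10 : W
word10 = (1F ∷ 0F ∷ []) Refinement., Irrelevant.[ ℕ.≤-refl , refl , refl ]

_≟ᵂ_ : (u v : W) → Dec (u ≡ v)
_≟ᵂ_ = Refinement._≟_ (≡-dec Fin._≟_)

ν₂[_]≡_ : ℕ → ℕ → Set
ν₂[ m ]≡ j = (2 ℕ.^ j ∣ m) × ¬ (2 ℕ.^ suc j ∣ m)

ν₂[_]≡?_ : ∀ m j → Dec (ν₂[ m ]≡ j)
ν₂[ m ]≡? j = (2 ℕ.^ j ∣? m) ×-dec ¬? (2 ℕ.^ suc j ∣? m)

ϑ₂ : ℕ → ℕ → ℕ
ϑ₂ j n = length (filter (λ t → ν₂[ n C t ]≡? j) (upTo (suc n)))

-- The denominator is nonzero because t = 0 is always counted.
ϑ₂-ratio : ℕ → ℕ → ℚ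
ϑ₂-ratio j n = + ϑ₂ j n / ϑ₂ 0 n

-- A monomial is a product of variables; lists differing only in the order of
-- the factors denote the same monomial.
Monomial : Set
Monomial = List W

exponent : W → Monomial → ℕ
exponent w m = length (filter (w ≟ᵂ_) m)

_≈ᴹ_ : Monomial → Monomial → Set
m ≈ᴹ m′ = All (λ w → exponent w m ≡ exponent w m′) (m ++ m′)

_≈ᴹ?_ : ∀ m m′ → Dec (m ≈ᴹ m′)
m ≈ᴹ? m′ = all? (λ w → exponent w m ℕ.≟ exponent w m′) (m ++ m′)

-- A finite formal sum of terms over ℚ; the same monomial may appear repeatedly.
Polynomial : Set
Polynomial = List (ℚ × Monomial)

sumℚ productℚ : List ℚ → ℚ
sumℚ     = foldr _+_ 0ℚ
productℚ = foldr _*_ 1ℚ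

coefficient : Monomial → Polynomial → ℚ
coefficient m p = sumℚ (map proj₁ (filter (λ t → proj₂ t ≈ᴹ? m) p))

eval : Polynomial → (W → ℚ) → ℚ
eval p x = sumℚ (map (λ t → proj₁ t * productℚ (map x (proj₂ t))) p)

X_ : W → Monomial
X w = w ∷ []

-- n ↦ (|n|_w)_{w ∈ W}
counts : ℕ → W → ℚ
counts n w = + occurrences n (value w) / 1

PowerSeries : Set
PowerSeries = ℕ → ℚ

[x^_]_ : ℕ → PowerSeries → ℚ
[x^ j ] f = f j

oneₛ : PowerSeries
oneₛ zero    = 1ℚ
oneₛ (suc _) = 0ℚ

x/2 : PowerSeries
x/2 1 = ½
x/2 _ = 0ℚ

_*ₛ_ : PowerSeries → PowerSeries → PowerSeries
(f *ₛ g) n = ∑[ i ≤ n ] (f (toℕ i) * g (n ℕ.∸ toℕ i))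

_^ₛ_ : PowerSeries → ℕ → PowerSeries
f ^ₛ zero  = oneₛ
f ^ₛ suc k = f *ₛ (f ^ₛ k)

-- log (1 + f) = Σ_{k ≥ 0} (-1)ᵏ f^{k+1} / (k+1) for f with zero constant term;
-- then xⁿ does not occur in f^{k+1} for k ≥ n, so the sum may stop at k < n.
log1+ : (f : PowerSeries) → f 0 ≡ 0ℚ → PowerSeries
log1+ f _ n = ∑[ k < n ] ((-1ℤ ℤ.^ toℕ k / suc (toℕ k)) * (f ^ₛ suc (toℕ k)) n)

IsCauchy : (ℕ → ℚ) → Set
IsCauchy s = ∀ ε → 0ℚ < ε → ∃[ N ] (∀ m n → N ℕ.≤ m → N ℕ.≤ n → ∣ s m - s n ∣ < ε)

-- Reals are Cauchy sequences of rationals.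
record ℝ : Set where
  field
    approx : ℕ → ℚ
    cauchy : IsCauchy approx

open ℝ public

-- The series Σ_{j ≥ 0} a j converges to r.
_HasSum_ : (ℕ → ℚ) → ℝ → Set
a HasSum r = ∀ ε → 0ℚ < ε →
  ∃[ N ] (∀ m n → N ℕ.≤ m → N ℕ.≤ n → ∣ (∑[ j < m ] a (toℕ j)) - approx r n ∣ < ε)

midpoint : ℚ → ℚ → ℚ
midpoint a b = ½ * (a + b)

-- Riemann sums of ∫ₐᵇ f over 2ᵏ subintervals of equal length, sampled at the
-- endpoints nearer to b, resp. nearer to a.  The orientation is as usual for
-- b < a.
riemann riemann′ : (ℚ → ℚ) → ℕ → ℚ → ℚ → ℚ
riemann f zero    a b = (b - a) * f b
riemann f (suc k) a b = riemann f k a (midpoint a b) + riemann f k (midpoint a b) b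
riemann′ f zero    a b = (b - a) * f a
riemann′ f (suc k) a b = riemann′ f k a (midpoint a b) + riemann′ f k (midpoint a b) b

recip : ℚ → ℚ
recip (mkℚ (+ 0) _ _)         = 0ℚ
recip q@(mkℚ (+ suc _) _ _)   = 1/ q
recip q@(mkℚ -[1+ _ ] _ _)    = 1/ q

module Convergence where

  open ℚ.≤-Reasoning
  open +-*-Solver

  *-recip : ∀ q → 0ℚ < q → q * recip q ≡ 1ℚ
  *-recip q@(mkℚ (+ suc _) _ _) _ = ℚ.*-inverseʳ q
  *-recip (mkℚ (+ 0) _ _) (*<* (ℤ.+<+ ()))
  *-recip (mkℚ -[1+ _ ] _ _) (*<* ())

  0<⇒0<recip : ∀ q → 0ℚ < q → 0ℚ < recip q
  0<⇒0<recip q@(mkℚ (+ suc _) _ _) _ = ℚ.positive⁻¹ (1/ q) {{ℚ.1/pos⇒pos q}}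
  0<⇒0<recip (mkℚ (+ 0) _ _) (*<* (ℤ.+<+ ()))
  0<⇒0<recip (mkℚ -[1+ _ ] _ _) (*<* ())

  0<+ : ∀ {p q} → 0ℚ < p → 0ℚ < q → 0ℚ < p + q
  0<+ = ℚ.+-mono-<

  0<* : ∀ {p q} → 0ℚ < p → 0ℚ < q → 0ℚ < p * q
  0<* {p} {q} 0<p 0<q =
    ℚ.positive⁻¹ (p * q) {{ℚ.pos*pos⇒pos p {{positive 0<p}} q {{positive 0<q}}}}

  0≤* : ∀ {p q} → 0ℚ ≤ p → 0ℚ ≤ q → 0ℚ ≤ p * q
  0≤* {p} {q} 0≤p 0≤q = ℚ.nonNegative⁻¹ (p * q)
    {{ℚ.nonNeg*nonNeg⇒nonNeg p {{nonNegative 0≤p}} q {{nonNegative 0≤q}}}}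

  0≤square : ∀ p → 0ℚ ≤ p * p
  0≤square p with ℚ.≤-total 0ℚ p
  ... | inj₁ 0≤p = 0≤* 0≤p 0≤p
  ... | inj₂ p≤0 = subst (0ℚ ≤_) (solve 1 (λ x → (:- x) :* (:- x) := x :* x) refl p)
                     (0≤* (ℚ.neg-antimono-≤ p≤0) (ℚ.neg-antimono-≤ p≤0))

  ≤-from-difference : ∀ {p q} d → p + d ≡ q → 0ℚ ≤ d → p ≤ q
  ≤-from-difference {p} d refl 0≤d =
    subst (_≤ p + d) (ℚ.+-identityʳ p) (ℚ.+-monoʳ-≤ p 0≤d)

  0<midpoint : ∀ {a b} → 0ℚ < a → 0ℚ < b → 0ℚ < midpoint a b
  0<midpoint 0<a 0<b = 0<* {½} (ℚ.positive⁻¹ ½) (0<+ 0<a 0<b)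

  -- ((b-a)/2)² times the reciprocals at two points
  correction : ℚ → ℚ → ℚ → ℚ → ℚ
  correction a b x y = (½ * (b - a)) * (½ * (b - a)) * (recip x * recip y)

  0≤correction : ∀ a b {x y} → 0ℚ < x → 0ℚ < y → 0ℚ ≤ correction a b x y
  0≤correction a b {x} {y} 0<x 0<y =
    0≤* (0≤square (½ * (b - a)))
        (ℚ.<⇒≤ (0<* (0<⇒0<recip x 0<x) (0<⇒0<recip y 0<y)))

  expand : ∀ p q c → q * recip q ≡ 1ℚ → c * recip p ≡ c * (q * recip q) * recip p
  expand p q c eq = cong (_* recip p)
    (trans (sym (ℚ.*-identityʳ c)) (cong (c *_) (sym eq)))

  lower-step : ∀ {a b} → 0ℚ < a → 0ℚ < b → riemann recip 0 a b ≤ riemann recip 1 a b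
  lower-step {a} {b} 0<a 0<b =
    ≤-from-difference (correction a b m b) eq (0≤correction a b 0<m 0<b)
    where
    m = midpoint a b
    0<m = 0<midpoint 0<a 0<b
    rb = recip b
    rm = recip m
    h = ½ * (b - a)
    eq : (b - a) * rb + correction a b m b ≡ (m - a) * rm + (b - m) * rb
    eq = begin-equality
      (b - a) * rb + h * h * (rm * rb)
        ≡⟨ solve 4 (λ a b rm rb →
             let h = con ½ :* (b :- a) ; m = con ½ :* (a :+ b) in
             (b :- a) :* rb :+ h :* h :* (rm :* rb) :=
             (b :- a) :* rb :+ (h :* (b :* rb) :* rm :- h :* (m :* rm) :* rb))
             refl a b rm rb ⟩
      (b - a) * rb + (h * (b * rb) * rm - h * (m * rm) * rb)
        ≡⟨ cong (λ z → (b - a) * rb + z) (cong₂ _-_ (expand m b h (*-recip b 0<b))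
                                            (expand b m h (*-recip m 0<m))) ⟨
      (b - a) * rb + (h * rm - h * rb)
        ≡⟨ solve 4 (λ a b rm rb →
             let h = con ½ :* (b :- a) ; m = con ½ :* (a :+ b) in
             (b :- a) :* rb :+ (h :* rm :- h :* rb) :=
             (m :- a) :* rm :+ (b :- m) :* rb)
             refl a b rm rb ⟩
      (m - a) * rm + (b - m) * rb ∎

  upper-step : ∀ {a b} → 0ℚ < a → 0ℚ < b → riemann′ recip 1 a b ≤ riemann′ recip 0 a b
  upper-step {a} {b} 0<a 0<b =
    ≤-from-difference (correction a b a m) eq (0≤correction a b 0<a 0<m)
    where
    m = midpoint a b
    0<m = 0<midpoint 0<a 0<b
    ra = recip a
    rm = recip m
    h = ½ * (b - a)
    eq : (m - a) * ra + (b - m) * rm + correction a b a m ≡ (b - a) * ra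
    eq = begin-equality
      (m - a) * ra + (b - m) * rm + h * h * (ra * rm)
        ≡⟨ solve 4 (λ a b ra rm →
             let h = con ½ :* (b :- a) ; m = con ½ :* (a :+ b) in
             (m :- a) :* ra :+ (b :- m) :* rm :+ h :* h :* (ra :* rm) :=
             (m :- a) :* ra :+ (b :- m) :* rm :+ (h :* (m :* rm) :* ra :- h :* (a :* ra) :* rm))
             refl a b ra rm ⟩
      (m - a) * ra + (b - m) * rm + (h * (m * rm) * ra - h * (a * ra) * rm)
        ≡⟨ cong (λ z → (m - a) * ra + (b - m) * rm + z)
             (cong₂ _-_ (expand a m h (*-recip m 0<m)) (expand m a h (*-recip a 0<a))) ⟨
      (m - a) * ra + (b - m) * rm + (h * ra - h * rm)
        ≡⟨ solve 4 (λ a b ra rm →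
             let h = con ½ :* (b :- a) ; m = con ½ :* (a :+ b) in
             (m :- a) :* ra :+ (b :- m) :* rm :+ (h :* ra :- h :* rm) := (b :- a) :* ra)
             refl a b ra rm ⟩
      (b - a) * ra ∎

  lower-mono : ∀ k {a b} → 0ℚ < a → 0ℚ < b → riemann recip k a b ≤ riemann recip (suc k) a b
  lower-mono zero    0<a 0<b = lower-step 0<a 0<b
  lower-mono (suc k) 0<a 0<b =
    ℚ.+-mono-≤ (lower-mono k 0<a (0<midpoint 0<a 0<b)) (lower-mono k (0<midpoint 0<a 0<b) 0<b)

  upper-mono : ∀ k {a b} → 0ℚ < a → 0ℚ < b → riemann′ recip (suc k) a b ≤ riemann′ recip k a b
  upper-mono zero    0<a 0<b = upper-step 0<a 0<b
  upper-mono (suc k) 0<a 0<b =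
    ℚ.+-mono-≤ (upper-mono k 0<a (0<midpoint 0<a 0<b)) (upper-mono k (0<midpoint 0<a 0<b) 0<b)

  half^ : ℕ → ℚ
  half^ zero    = 1ℚ
  half^ (suc k) = ½ * half^ k

  gap : ∀ f k a b → riemann′ f k a b ≡ riemann f k a b + (b - a) * (f a - f b) * half^ k
  gap f zero a b =
    solve 4 (λ a b x y → (b :- a) :* x :=
                         (b :- a) :* y :+ (b :- a) :* (x :- y) :* con 1ℚ)
      refl a b (f a) (f b)
  gap f (suc k) a b = trans (cong₂ _+_ (gap f k a m) (gap f k m b))
    (solve 8 (λ a b x y z r s h →
       let m = con ½ :* (a :+ b) in
       (r :+ (m :- a) :* (x :- z) :* h) :+ (s :+ (b :- m) :* (z :- y) :* h) :=
       (r :+ s) :+ (b :- a) :* (x :- y) :* (con ½ :* h))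
      refl a b (f a) (f b) (f m) (riemann f k a m) (riemann f k m b) (half^ k))
    where m = midpoint a b

  0≤half^ : ∀ k → 0ℚ ≤ half^ k
  0≤half^ zero    = ℚ.nonNegative⁻¹ 1ℚ
  0≤half^ (suc k) = 0≤* {½} (ℚ.nonNegative⁻¹ ½) (0≤half^ k)

  half^≤1 : ∀ k → half^ k ≤ 1ℚ
  half^≤1 zero    = ℚ.≤-refl
  half^≤1 (suc k) = ℚ.≤-trans (ℚ.*-monoˡ-≤-nonNeg ½ (half^≤1 k)) (ℚ.<⇒≤ ½<1)
    where ½<1 : ½ * 1ℚ < 1ℚ
          ½<1 = *<* (ℤ.+<+ (ℕ.s≤s (ℕ.s≤s ℕ.z≤n)))

  fromℕ : ℕ → ℚ
  fromℕ zero    = 0ℚ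
  fromℕ (suc n) = 1ℚ + fromℕ n

  n/2ⁿ<1 : ∀ n → fromℕ n * half^ n < 1ℚ
  n/2ⁿ<1 zero    = ℚ.positive⁻¹ 1ℚ
  n/2ⁿ<1 (suc n) = begin-strict
    (1ℚ + fromℕ n) * (½ * half^ n)
      ≡⟨ solve 2 (λ x h → (con 1ℚ :+ x) :* (con ½ :* h) := con ½ :* (h :+ x :* h))
           refl (fromℕ n) (half^ n) ⟩
    ½ * (half^ n + fromℕ n * half^ n)
      <⟨ ℚ.*-monoʳ-<-pos ½ (ℚ.+-mono-≤-< (half^≤1 n) (n/2ⁿ<1 n)) ⟩
    ½ * (1ℚ + 1ℚ)
      ≡⟨⟩
    1ℚ ∎

  toℚᵘ-fromℕ : ∀ n → toℚᵘ (fromℕ n) ℚᵘ.≃ ℚᵘ.mkℚᵘ (+ n) 0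
  toℚᵘ-fromℕ zero    = ℚᵘ.*≡* refl
  toℚᵘ-fromℕ (suc n) =
    ℚᵘ.≃-trans (ℚ.toℚᵘ-homo-+ 1ℚ (fromℕ n))
      (ℚᵘ.≃-trans (ℚᵘ.+-congʳ ℚᵘ.1ℚᵘ (toℚᵘ-fromℕ n))
        (ℚᵘ.*≡* (cong (ℤ._* + 1) (cong (λ z → + 1 ℤ.+ z) (ℤ.*-identityʳ (+ n))))))

  ceiling-bound : ∀ q → q ≤ fromℕ ℤ.∣ ↥ q ∣
  ceiling-bound q@record{} = ℚ.toℚᵘ-cancel-≤
    (ℚᵘ.≤-respʳ-≃ (ℚᵘ.≃-sym (toℚᵘ-fromℕ ℤ.∣ ↥ q ∣)) (ℚᵘ.*≤* bound))
    where
    bound : ↥ q ℤ.* + 1 ℤ.≤ + ℤ.∣ ↥ q ∣ ℤ.* ↧ q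
    bound = ℤ.≤-trans (ℤ.≤-reflexive (ℤ.*-identityʳ (↥ q)))
      (ℤ.≤-trans (i≤∣i∣ (↥ q))
        (ℤ.≤-trans (ℤ.+≤+ (ℕ.m≤m*n ℤ.∣ ↥ q ∣ (↧ₙ q)))
          (ℤ.≤-reflexive (ℤ.pos-* ℤ.∣ ↥ q ∣ (↧ₙ q)))))
      where
      i≤∣i∣ : ∀ i → i ℤ.≤ + ℤ.∣ i ∣
      i≤∣i∣ (+ n)    = ℤ.≤-refl
      i≤∣i∣ -[1+ n ] = ℤ.-≤+

  vanishing : ∀ K ε → 0ℚ < ε → ∃[ N ] K * half^ N < ε
  vanishing K ε 0<ε = ℤ.∣ ↥ (K * recip ε) ∣ , below ℤ.∣ ↥ (K * recip ε) ∣ (ceiling-bound (K * recip ε))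
    where
    below : ∀ N → K * recip ε ≤ fromℕ N → K * half^ N < ε
    below N K/ε≤N = begin-strict
      K * half^ N                ≡⟨ cong (_* half^ N) (ℚ.*-identityˡ K) ⟨
      1ℚ * K * half^ N           ≡⟨ cong (λ z → z * K * half^ N) (*-recip ε 0<ε) ⟨
      ε * recip ε * K * half^ N  ≡⟨ solve 4 (λ e r c h → e :* r :* c :* h := e :* (c :* r :* h))
                                      refl ε (recip ε) K (half^ N) ⟩
      ε * (K * recip ε * half^ N)
        ≤⟨ ℚ.*-monoˡ-≤-nonNeg ε {{ℚ.pos⇒nonNeg ε {{positive 0<ε}}}}
             (ℚ.*-monoʳ-≤-nonNeg (half^ N) {{nonNegative (0≤half^ N)}} K/ε≤N) ⟩
      ε * (fromℕ N * half^ N)    <⟨ ℚ.*-monoʳ-<-pos ε {{positive 0<ε}} (n/2ⁿ<1 N) ⟩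
      ε * 1ℚ                     ≡⟨ ℚ.*-identityʳ ε ⟩
      ε                          ∎

  ∣-∣-bound : ∀ {p q r} → p - q ≤ r → q - p ≤ r → ∣ p - q ∣ ≤ r
  ∣-∣-bound {p} {q} {r} p-q≤r q-p≤r with ℚ.∣p∣≡p∨∣p∣≡-p (p - q)
  ... | inj₁ eq = subst (_≤ r) (sym eq) p-q≤r
  ... | inj₂ eq = subst (_≤ r) (sym (trans eq (solve 2 (λ x y → :- (x :- y) := y :- x) refl p q)))
                    q-p≤r

  module _ {a b : ℚ} (0<a : 0ℚ < a) (0<b : 0ℚ < b) where

    lower upper : ℕ → ℚ
    lower k = riemann recip k a b
    upper k = riemann′ recip k a b

    width : ℚ
    width = (b - a) * (recip a - recip b)

    lower-≤ : ∀ {m n} → m ℕ.≤′ n → lower m ≤ lower n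
    lower-≤ (ℕ.≤′-reflexive refl) = ℚ.≤-refl
    lower-≤ (ℕ.≤′-step {n = n} m≤n) = ℚ.≤-trans (lower-≤ m≤n) (lower-mono n 0<a 0<b)

    upper-≤ : ∀ {m n} → m ℕ.≤′ n → upper n ≤ upper m
    upper-≤ (ℕ.≤′-reflexive refl) = ℚ.≤-refl
    upper-≤ (ℕ.≤′-step {n = n} m≤n) = ℚ.≤-trans (upper-mono n 0<a 0<b) (upper-≤ m≤n)

    0≤width : 0ℚ ≤ width
    0≤width = subst (0ℚ ≤_) eq
      (0≤* (0≤square (b - a)) (ℚ.<⇒≤ (0<* (0<⇒0<recip a 0<a) (0<⇒0<recip b 0<b))))
      where
      eq : (b - a) * (b - a) * (recip a * recip b) ≡ width
      eq = begin-equality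
        (b - a) * (b - a) * (recip a * recip b)
          ≡⟨ solve 4 (λ a b x y → (b :- a) :* (b :- a) :* (x :* y) :=
                       (b :- a) :* (b :* y) :* x :- (b :- a) :* (a :* x) :* y)
               refl a b (recip a) (recip b) ⟩
        (b - a) * (b * recip b) * recip a - (b - a) * (a * recip a) * recip b
          ≡⟨ cong₂ _-_ (expand a b (b - a) (*-recip b 0<b))
                       (expand b a (b - a) (*-recip a 0<a)) ⟨
        (b - a) * recip a - (b - a) * recip b
          ≡⟨ solve 4 (λ a b x y → (b :- a) :* x :- (b :- a) :* y := (b :- a) :* (x :- y))
               refl a b (recip a) (recip b) ⟩
        width ∎

    lower≤upper : ∀ k → lower k ≤ upper k
    lower≤upper k = ≤-from-difference (width * half^ k) (sym (gap recip k a b))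
                      (0≤* 0≤width (0≤half^ k))

    one-sided : ∀ N {m n} → N ℕ.≤ m → N ℕ.≤ n → lower m - lower n ≤ width * half^ N
    one-sided N {m} {n} N≤m N≤n = begin
      lower m - lower n
        ≤⟨ ℚ.+-mono-≤ (ℚ.≤-trans (lower≤upper m) (upper-≤ (ℕ.≤⇒≤′ N≤m)))
                      (ℚ.neg-antimono-≤ (lower-≤ (ℕ.≤⇒≤′ N≤n))) ⟩
      upper N - lower N
        ≡⟨ cong (_- lower N) (gap recip N a b) ⟩
      lower N + width * half^ N - lower N
        ≡⟨ solve 2 (λ x y → x :+ y :- x := y) refl (lower N) (width * half^ N) ⟩
      width * half^ N ∎

    two-sided : ∀ N {m n} → N ℕ.≤ m → N ℕ.≤ n → ∣ lower m - lower n ∣ ≤ width * half^ N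
    two-sided N {m} {n} N≤m N≤n = ∣-∣-bound {lower m} {lower n} (one-sided N N≤m N≤n) (one-sided N N≤n N≤m)

    lower-cauchy : IsCauchy lower
    lower-cauchy ε 0<ε = proj₁ small , λ m n N≤m N≤n →
      ℚ.≤-<-trans (two-sided (proj₁ small) N≤m N≤n) (proj₂ small)
      where small = vanishing width ε 0<ε

-- log q = ∫₁^q dt/t, the limit of Riemann sums.  They increase with k, and the
-- companion sums riemann′ decrease, which gives the Cauchy property.
log : (q : ℚ) → .{{Positive q}} → ℝ
log q = record
  { approx = λ k → riemann recip k 1ℚ q
  ; cauchy = Convergence.lower-cauchy (ℚ.positive⁻¹ 1ℚ) (ℚ.positive⁻¹ q)
  }

{-# OPTIONS --safe #-}
-- The numbers ϑ₂(j, n) satisfy Carlitz' recurrences in the binary digits of n.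
-- In terms of Tₙ = Σⱼ ϑ₂(j, n) xʲ / ϑ₂(0, n) and a companion series Uₙ, these are
--   T₂ₙ = Tₙ + x Uₙ,  U₂ₙ = 2x Uₙ,  T₂ₙ₊₁ = Tₙ,  U₂ₙ₊₁ = ½ (Tₙ + x Uₙ).
-- Modulo xᴸ a block 1ᴸ0ᴸ therefore acts on T as a fixed operator that commutes
-- with x, and a following 10 multiplies T by 1 + x/2.  Hence the numbers n and n′
-- with binary expansions (1ᴸ0ᴸ)ᵗ and (1ᴸ0ᴸ10)ᵗ satisfy T_{n′} = (1 + x/2)ᵗ Tₙ
-- modulo xᴸ.  Their counts of a word w ∈ W of length at most L are t v(w) and
-- t (v(w) + [w = 10]).  So both sides of this identity have coefficients that are
-- polynomials in t, and comparing the linear terms leaves the coefficient of X₁₀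
-- equal to the linear term of [xʲ] (1 + x/2)ᵗ.
-- For the sum, the Riemann sums of 1/t are compared with those of the partial
-- sums of the geometric series in t - 1, integrated term by term.
module Submission where

open import Defs
open Convergence
  using (fromℕ; toℚᵘ-fromℕ; half^; *-recip; 0<⇒0<recip; 0≤*; 0≤half^; half^≤1;
         ∣-∣-bound; vanishing; gap; ≤-from-difference)
open import Data.Bool.Base using (if_then_else_; true; false)
open import Data.Fin.Base as Fin using (Fin; toℕ; inject₁)
open import Data.Fin.Patterns using (0F; 1F)
import Data.Fin.Properties as Fin
open import Data.Integer.Base as ℤ using (+_; -[1+_]; -1ℤ)
import Data.Integer.Properties as ℤ
open import Data.Irrelevant using ([_])
open import Data.List.Base
  using (List; []; _∷_; _++_; length; map; foldr; filter; upTo; downFrom; head; last)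
import Data.List.Properties as List
open import Data.List.Relation.Unary.All using ([]; _∷_)
open import Data.Maybe.Base using (just)
import Data.Maybe.Properties as Maybe
open import Data.Nat.Base as ℕ using (ℕ; zero; suc; z≤n; s≤s)
open import Data.Nat.Combinatorics using (_C_; nCk+nC[k+1]≡[n+1]C[k+1]; nC1≡n)
open import Data.Nat.Divisibility as ℕ using (_∣_)
import Data.Nat.DivMod as ℕ
open import Data.Nat.Primality using (euclidsLemma; prime[2])
import Data.Nat.Properties as ℕ
open import Data.Nat.Solver using () renaming (module +-*-Solver to ℕ-Solver)
open import Data.Product.Base using (_×_; ∃-syntax; _,_; proj₁; proj₂)
open import Data.Rational.Base as ℚ
  using (ℚ; 0ℚ; 1ℚ; ½; _/_; _+_; _*_; _-_; -_; _≤_; _<_; toℚᵘ; nonNegative)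
import Data.Rational.Properties as ℚ
open import Data.Rational.Solver using (module +-*-Solver)
import Data.Rational.Unnormalised.Base as ℚᵘ
import Data.Rational.Unnormalised.Properties as ℚᵘ
open import Data.Refinement using (value; proof; value-injective)
open import Data.Sum.Base using (inj₁; inj₂; [_,_]′)
open import Data.Vec.Functional using (Vector)
open import Algebra.Properties.CommutativeMonoid.Sum ℚ.+-0-commutativeMonoid
  using (sum; sum-syntax; sum-cong-≗; sum-init-last)
open import Algebra.Properties.Group ℚ.+-0-group using (∙-cancelˡ)
open import Relation.Binary.PropositionalEquality
open import Relation.Nullary using (Dec; does; yes; no; ¬_; contradiction)
open import Relation.Nullary.Decidable using (recompute; _×-dec_)
open import Relation.Unary using (Pred; Decidable)

-- Counting words

-- A value of `P j` at one n mixes all words, so a single coefficient becomes visible only along a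
-- family of n whose counts are exactly proportional to a parameter t. Inserting 10 into a number
-- usually creates longer words of `W` across the seam. The runs of the block prevent this: a window
-- of length 3 to L that ends with an inserted 10 begins in the zeros above it, and one that ends in
-- the zeros of the next block cannot reach beyond the ones of that block. The same runs serve the
-- series. The L ones push the incoming U past the precision xᴸ, which makes the block an operator
-- on T alone. The L zeros multiply U by x each, so U vanishes modulo xᴸ before the 10; its digit 1
-- then makes U equal to T/2, and its digit 0 adds (x/2) T to T. This is the origin of 1 + x/2. The
-- derivative of `P j` along v is unknown, but it occurs on both sides and cancels. The logarithm
-- enters as the derivative of (1 + x/2)ᵗ at t = 0, where T has the value 1.

indicator : ∀ {p} {P : Set p} → Dec P → ℕ
indicator d = if does d then 1 else 0

indicator-yes : ∀ {p} {P : Set p} (d : Dec P) → P → indicator d ≡ 1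
indicator-yes (yes _) _ = refl
indicator-yes (no ¬p) p = contradiction p ¬p

indicator-no : ∀ {p} {P : Set p} (d : Dec P) → ¬ P → indicator d ≡ 0
indicator-no (yes p) ¬p = contradiction p ¬p
indicator-no (no _)  _  = refl

indicator-cong : ∀ {p q} {P : Set p} {Q : Set q} (P? : Dec P) (Q? : Dec Q) →
                 (P → Q) → (Q → P) → indicator P? ≡ indicator Q?
indicator-cong P? (yes q) _   Q⇒P = indicator-yes P? (Q⇒P q)
indicator-cong P? (no ¬q) P⇒Q _   = indicator-no P? (λ p → ¬q (P⇒Q p))

sumTo : ℕ → (ℕ → ℕ) → ℕ
sumTo zero    f = 0
sumTo (suc n) f = sumTo n f ℕ.+ f n

sumTo-cong : ∀ {f g} n → (∀ i → i ℕ.< n → f i ≡ g i) → sumTo n f ≡ sumTo n g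
sumTo-cong zero    f≡g = refl
sumTo-cong (suc n) f≡g = cong₂ ℕ._+_ (sumTo-cong n (λ i i<n → f≡g i (ℕ.m<n⇒m<1+n i<n)))
  (f≡g n ℕ.≤-refl)

sumTo-suc : ∀ f n → sumTo (suc n) f ≡ f 0 ℕ.+ sumTo n (λ i → f (suc i))
sumTo-suc f zero    = sym (ℕ.+-identityʳ (f 0))
sumTo-suc f (suc n) = trans (cong (ℕ._+ f (suc n)) (sumTo-suc f n)) (ℕ.+-assoc (f 0) _ _)

sumTo-extend : ∀ {f n} → (∀ i → n ℕ.≤ i → f i ≡ 0) → ∀ {m} → n ℕ.≤ m → sumTo m f ≡ sumTo n f
sumTo-extend {f} {n} f≡0 n≤m = extend (ℕ.≤⇒≤′ n≤m)
  where
  extend : ∀ {m} → n ℕ.≤′ m → sumTo m f ≡ sumTo n f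
  extend (ℕ.≤′-reflexive refl)     = refl
  extend {suc m} (ℕ.≤′-step n≤′m) =
    trans (cong₂ ℕ._+_ (extend n≤′m) (f≡0 m (ℕ.≤′⇒≤ n≤′m))) (ℕ.+-identityʳ _)

length-filter-upTo : ∀ {p} {P : Pred ℕ p} (P? : Decidable P) n →
                     length (filter P? (upTo n)) ≡ sumTo n (λ i → indicator (P? i))
length-filter-upTo P? zero    = refl
length-filter-upTo P? (suc n) = begin
  length (filter P? (upTo (suc n)))
    ≡⟨ cong (λ is → length (filter P? is)) (List.upTo-∷ʳ n) ⟨
  length (filter P? (upTo n ++ n ∷ []))
    ≡⟨ cong length (List.filter-++ P? (upTo n) (n ∷ [])) ⟩
  length (filter P? (upTo n) ++ filter P? (n ∷ []))
    ≡⟨ List.length-++ (filter P? (upTo n)) ⟩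
  length (filter P? (upTo n)) ℕ.+ length (filter P? (n ∷ []))
    ≡⟨ cong₂ ℕ._+_ (length-filter-upTo P? n) singleton ⟩
  sumTo n (λ i → indicator (P? i)) ℕ.+ indicator (P? n) ∎
  where
  open ≡-Reasoning
  singleton : length (filter P? (n ∷ [])) ≡ indicator (P? n)
  singleton with does (P? n)
  ... | true  = refl
  ... | false = refl

-- Appending binary digits

infixl 6 _▹_
-- In this form `n ▹ 0F` and `n ▹ 1F` compute to twice n and its successor, on which the row sums in
-- the recurrences rely.
_▹_ : ℕ → Fin 2 → ℕ
n ▹ d = toℕ d ℕ.+ n ℕ.* 2

▹/2 : ∀ n d → (n ▹ d) ℕ./ 2 ≡ n
▹/2 n 0F = ℕ.m*n/n≡m n 2
▹/2 n 1F = trans (ℕ.+-distrib-/-∣ʳ 1 {n ℕ.* 2} (ℕ.divides n refl)) (ℕ.m*n/n≡m n 2)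

▹mod2 : ∀ n d → (n ▹ d) ℕ.mod 2 ≡ d
▹mod2 n d = Fin.toℕ-injective (begin
  toℕ ((n ▹ d) ℕ.mod 2)  ≡⟨ Fin.toℕ-fromℕ< _ ⟩
  (n ▹ d) ℕ.% 2          ≡⟨ ℕ.[m+kn]%n≡m%n (toℕ d) n 2 ⟩
  toℕ d ℕ.% 2            ≡⟨ ℕ.m<n⇒m%n≡m (Fin.toℕ<n d) ⟩
  toℕ d                  ∎)
  where open ≡-Reasoning

digit-▹-suc : ∀ n d i → digit (n ▹ d) (suc i) ≡ digit n i
digit-▹-suc n d i = cong (λ m → digit m i) (▹/2 n d)

digit-beyond : ∀ {n} i → n ℕ.≤ i → digit n i ≡ 0F
digit-beyond zero z≤n = refl
digit-beyond {n} (suc i) n≤1+i = digit-beyond i (ℕ.≤-trans (ℕ./-monoˡ-≤ 2 n≤1+i) (half i))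
  where
  half : ∀ i → suc i ℕ./ 2 ℕ.≤ i
  half i = ℕ.≤-pred (ℕ.m/n<m (suc i) 2 (s≤s (s≤s z≤n)))

window-▹-suc : ∀ n d i μ → window (n ▹ d) (suc i) μ ≡ window n i μ
window-▹-suc n d i μ = List.map-cong (λ k → digit-▹-suc n d (i ℕ.+ k)) (downFrom μ)

last-window : ∀ n μ → last (window n 0 (suc μ)) ≡ just (digit n 0)
last-window n zero    = refl
last-window n (suc μ) = last-window n μ

SameLow : ℕ → ℕ → ℕ → Set
SameLow k m n = ∀ i → i ℕ.< k → digit m i ≡ digit n i

sameLow-▹ : ∀ {k m n} d → SameLow k m n → SameLow k (m ▹ d) (n ▹ d)
sameLow-▹ {m = m} {n} d same zero    i<k = trans (▹mod2 m d) (sym (▹mod2 n d))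
sameLow-▹ {m = m} {n} d same (suc i) i<k =
  trans (digit-▹-suc m d i) (trans (same i (ℕ.<-trans (ℕ.n<1+n i) i<k)) (sym (digit-▹-suc n d i)))

sameLow-window : ∀ {m n} μ → SameLow μ m n → window m 0 μ ≡ window n 0 μ
sameLow-window zero    same = refl
sameLow-window (suc μ) same =
  cong₂ _∷_ (same μ ℕ.≤-refl) (sameLow-window μ (λ i i<μ → same i (ℕ.m<n⇒m<1+n i<μ)))

-- The proof stored in a refinement is irrelevant; it can be recovered because `InW` is decidable.
inW : (w : W) → InW (value w)
inW w with proof w
... | [ w∈W ] = recompute ((2 ℕ.≤? length (value w)) ×-dec
  (Maybe.≡-dec Fin._≟_ (head (value w)) (just 1F)
                   ×-dec Maybe.≡-dec Fin._≟_ (last (value w)) (just 0F))) w∈W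

matches : ℕ → ℕ → Word → ℕ
matches n i w = indicator (List.≡-dec Fin._≟_ (window n i (length w)) w)

matches-▹-suc : ∀ n d i w → matches (n ▹ d) (suc i) w ≡ matches n i w
matches-▹-suc n d i w = cong (λ u → indicator (List.≡-dec Fin._≟_ u w))
  (window-▹-suc n d i (length w))

-- The leading 1 of `w` would sit at a position at or above `n`, where the digits of `n` are 0.
-- Hence every cutoff of at least `n` counts the same occurrences.
matches-beyond : ∀ {n i} w → InW w → n ℕ.≤ i → matches n i w ≡ 0
matches-beyond {n} {i} w (2≤∣w∣ , w≡1⋯ , _) n≤i =
  indicator-no (List.≡-dec Fin._≟_ (window n i (length w)) w) (mismatch w 2≤∣w∣ w≡1⋯)
  where
  mismatch : ∀ w → 2 ℕ.≤ length w → head w ≡ just 1F → window n i (length w) ≢ w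
  mismatch (x ∷ w) _ refl eq = contradiction
    (trans (sym (digit-beyond (i ℕ.+ length w) (ℕ.≤-trans n≤i (ℕ.m≤m+n i (length w)))))
      (List.∷-injectiveˡ eq)) λ ()

occurrences-▹ : ∀ n d w → InW w → occurrences (n ▹ d) w ≡ matches (n ▹ d) 0 w ℕ.+ occurrences n w
occurrences-▹ n d w w∈W = begin
  -- One position is added first, so that position 0 can be split off even if `n ▹ d` is 0.
  occurrences (n ▹ d) w                                         ≡⟨ length-filter-upTo _ (n ▹ d) ⟩
  sumTo (n ▹ d) (λ i → matches (n ▹ d) i w)                     ≡⟨ sumTo-extend
      (λ i → matches-beyond w w∈W) (ℕ.n≤1+n (n ▹ d)) ⟨
  sumTo (suc (n ▹ d)) (λ i → matches (n ▹ d) i w)               ≡⟨ sumTo-suc _ (n ▹ d) ⟩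
  matches (n ▹ d) 0 w ℕ.+ sumTo (n ▹ d) (λ i → matches (n ▹ d) (suc i) w)
    ≡⟨ cong (matches (n ▹ d) 0 w ℕ.+_) (sumTo-cong (n ▹ d) (λ i _ → matches-▹-suc n d i w)) ⟩
  matches (n ▹ d) 0 w ℕ.+ sumTo (n ▹ d) (λ i → matches n i w)
    ≡⟨ cong (matches (n ▹ d) 0 w ℕ.+_) (sumTo-extend (λ i → matches-beyond w w∈W)
         (ℕ.≤-trans (ℕ.m≤m*n n 2) (ℕ.m≤n+m (n ℕ.* 2) (toℕ d)))) ⟩
  matches (n ▹ d) 0 w ℕ.+ sumTo n (λ i → matches n i w)
    ≡⟨ cong (matches (n ▹ d) 0 w ℕ.+_) (length-filter-upTo _ n) ⟨
  matches (n ▹ d) 0 w ℕ.+ occurrences n w ∎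
  where open ≡-Reasoning

-- Words of `W` end in 0, so none of them matches at the new last digit 1.
occurrences-▹1 : ∀ n w → InW w → occurrences (n ▹ 1F) w ≡ occurrences n w
occurrences-▹1 n w w∈W@(2≤∣w∣ , _ , w≡⋯0) = trans (occurrences-▹ n 1F w w∈W)
  (cong (ℕ._+ occurrences n w) (indicator-no (List.≡-dec Fin._≟_
      (window (n ▹ 1F) 0 (length w)) w) mismatch))
  where
  last-window′ : ∀ μ → 2 ℕ.≤ μ → last (window (n ▹ 1F) 0 μ) ≡ just 1F
  last-window′ (suc μ) _ = trans (last-window (n ▹ 1F) μ) (cong just (▹mod2 n 1F))
  mismatch : window (n ▹ 1F) 0 (length w) ≢ w
  mismatch eq = contradiction (trans (sym (last-window′ (length w) 2≤∣w∣))
      (trans (cong last eq) w≡⋯0)) λ ()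

append : Fin 2 → ℕ → ℕ → ℕ
append d zero    n = n
append d (suc k) n = append d k n ▹ d

digit-append : ∀ d k n i → i ℕ.< k → digit (append d k n) i ≡ d
digit-append d (suc k) n zero    _         = ▹mod2 (append d k n) d
digit-append d (suc k) n (suc i) (s≤s i<k) = trans (digit-▹-suc (append d k n) d i)
  (digit-append d k n i i<k)

block : ℕ → ℕ → ℕ
block L n = append 0F L (append 1F L n)

occurrences-append-1 : ∀ k n w → InW w → occurrences (append 1F k n) w ≡ occurrences n w
occurrences-append-1 zero    n w w∈W = refl
occurrences-append-1 (suc k) n w w∈W = trans (occurrences-▹1 (append 1F k n) w w∈W)
  (occurrences-append-1 k n w w∈W)

module _ {L} (w : Word) (w∈W : InW w) (∣w∣≤L : length w ℕ.≤ L) where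

  sameLow-append : ∀ {m n} d k → SameLow L m n → SameLow L (append d k m) (append d k n)
  sameLow-append d zero    same = same
  sameLow-append d (suc k) same = sameLow-▹ d (sameLow-append d k same)

  -- Each appended digit tests only a window within the lowest `L` digits, where both numbers agree,
  -- so the two counts grow equally. Cross sums avoid subtraction in ℕ.
  occurrences-append-sameLow : ∀ {m n} d k → SameLow L m n →
    occurrences (append d k m) w ℕ.+ occurrences n w ≡
      occurrences (append d k n) w ℕ.+ occurrences m w
  occurrences-append-sameLow {m} {n} d zero    same = ℕ.+-comm (occurrences m w) (occurrences n w)
  occurrences-append-sameLow {m} {n} d (suc k) same = begin
    occurrences (m′ ▹ d) w ℕ.+ occurrences n w
      ≡⟨ cong (ℕ._+ occurrences n w) (occurrences-▹ m′ d w w∈W) ⟩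
    matches (m′ ▹ d) 0 w ℕ.+ occurrences m′ w ℕ.+ occurrences n w
      ≡⟨ ℕ.+-assoc (matches (m′ ▹ d) 0 w) _ _ ⟩
    matches (m′ ▹ d) 0 w ℕ.+ (occurrences m′ w ℕ.+ occurrences n w)
      ≡⟨ cong₂ ℕ._+_ (cong (λ u → indicator (List.≡-dec Fin._≟_ u w))
           (sameLow-window (length w) (λ i i<∣w∣ →
             sameLow-append d (suc k) same i (ℕ.≤-trans i<∣w∣ ∣w∣≤L))))
           (occurrences-append-sameLow d k same) ⟩
    matches (n′ ▹ d) 0 w ℕ.+ (occurrences n′ w ℕ.+ occurrences m w)
      ≡⟨ ℕ.+-assoc (matches (n′ ▹ d) 0 w) _ _ ⟨
    matches (n′ ▹ d) 0 w ℕ.+ occurrences n′ w ℕ.+ occurrences m w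
      ≡⟨ cong (ℕ._+ occurrences m w) (occurrences-▹ n′ d w w∈W) ⟨
    occurrences (n′ ▹ d) w ℕ.+ occurrences m w ∎
    where
    open ≡-Reasoning
    m′ = append d k m
    n′ = append d k n

  -- Appending ones adds nothing. While the zeros are appended, a window reaches at most into the
  -- `L` ones, which hide `n`, so the gain is the same as above the number 0.
  occurrences-block : ∀ n → occurrences (block L n) w ≡
      occurrences (block L 0) w ℕ.+ occurrences n w
  occurrences-block n = begin
    occurrences (block L n) w
      ≡⟨ ℕ.+-identityʳ _ ⟨
    occurrences (block L n) w ℕ.+ 0
      ≡⟨ cong (occurrences (block L n) w ℕ.+_) (occurrences-append-1 L 0 w w∈W) ⟨
    occurrences (block L n) w ℕ.+ occurrences (append 1F L 0) w
      ≡⟨ occurrences-append-sameLow 0F L (λ i i<L →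
           trans (digit-append 1F L n i i<L) (sym (digit-append 1F L 0 i i<L))) ⟩
    occurrences (block L 0) w ℕ.+ occurrences (append 1F L n) w
      ≡⟨ cong (occurrences (block L 0) w ℕ.+_) (occurrences-append-1 L n w w∈W) ⟩
    occurrences (block L 0) w ℕ.+ occurrences n w ∎
    where open ≡-Reasoning

window-10 : ∀ n → window (n ▹ 1F ▹ 0F) 0 2 ≡ 1F ∷ 0F ∷ []
window-10 n = cong₂ (λ x y → x ∷ y ∷ []) (trans (digit-▹-suc (n ▹ 1F) 0F 0) (▹mod2 n 1F))
  (▹mod2 (n ▹ 1F) 0F)

-- A longer window of at most `L` letters has its leading letter among the zeros, whereas words of
-- `W` begin with 1.
matches-10 : ∀ {L} n (w : W) → length (value w) ℕ.≤ L →
  matches (append 0F L n ▹ 1F ▹ 0F) 0 (value w) ≡ indicator (w ≟ᵂ word10)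
matches-10 {L} n w ∣w∣≤L = compare (w ≟ᵂ word10)
  where
  mismatch : ∀ w → InW w → length w ℕ.≤ L → w ≢ 1F ∷ 0F ∷ [] →
             window (append 0F L n ▹ 1F ▹ 0F) 0 (length w) ≢ w
  mismatch (_ ∷ []) (s≤s () , _)
  mismatch w@(_ ∷ _ ∷ []) _ _ w≢10 eq = w≢10 (trans (sym eq) (window-10 (append 0F L n)))
  mismatch (_ ∷ _ ∷ _ ∷ w) (_ , refl , _) ∣w∣≤L _ eq = contradiction (begin
    0F                                                ≡⟨ digit-append 0F L n (length w)
      (ℕ.≤-trans (s≤s (ℕ.m≤n+m (length w) 2)) ∣w∣≤L) ⟨
    digit (append 0F L n) (length w)                  ≡⟨ digit-▹-suc (append 0F L n) 1F (length w) ⟨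
    digit (append 0F L n ▹ 1F) (suc (length w))       ≡⟨ digit-▹-suc (append 0F L n ▹ 1F) 0F
      (suc (length w)) ⟨
    digit (append 0F L n ▹ 1F ▹ 0F) (2 ℕ.+ length w)  ≡⟨ List.∷-injectiveˡ eq ⟩
    1F                                                ∎) λ ()
    where open ≡-Reasoning
  compare : Dec (w ≡ word10) → matches (append 0F L n ▹ 1F ▹ 0F) 0 (value w) ≡
      indicator (w ≟ᵂ word10)
  compare (yes refl) = indicator-yes (List.≡-dec Fin._≟_ _ (value w)) (window-10 (append 0F L n))
  compare (no w≢10)  = trans
    (indicator-no (List.≡-dec Fin._≟_ _ (value w))
      (mismatch (value w) (inW w) ∣w∣≤L (λ eq → w≢10 (value-injective eq))))
    (sym (indicator-no (w ≟ᵂ word10) w≢10))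

blocks blocks10 : ℕ → ℕ → ℕ
blocks L zero    = 0
blocks L (suc t) = block L (blocks L t)
blocks10 L zero    = 0
blocks10 L (suc t) = block L (blocks10 L t) ▹ 1F ▹ 0F

occurrences-blocks : ∀ L t (w : W) → length (value w) ℕ.≤ L →
  occurrences (blocks L t) (value w) ≡ t ℕ.* occurrences (block L 0) (value w)
occurrences-blocks L zero    w ∣w∣≤L = refl
occurrences-blocks L (suc t) w ∣w∣≤L = trans (occurrences-block (value w) (inW w) ∣w∣≤L
  (blocks L t))
  (cong (occurrences (block L 0) (value w) ℕ.+_) (occurrences-blocks L t w ∣w∣≤L))

occurrences-blocks10 : ∀ L t (w : W) → length (value w) ℕ.≤ L →
  occurrences (blocks10 L t) (value w) ≡ t ℕ.*
      (occurrences (block L 0) (value w) ℕ.+ indicator (w ≟ᵂ word10))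
occurrences-blocks10 L zero    w ∣w∣≤L = refl
occurrences-blocks10 L (suc t) w ∣w∣≤L = begin
  occurrences (b ▹ 1F ▹ 0F) (value w)
    ≡⟨ occurrences-▹ (b ▹ 1F) 0F (value w) (inW w) ⟩
  matches (b ▹ 1F ▹ 0F) 0 (value w) ℕ.+ occurrences (b ▹ 1F) (value w)
    ≡⟨ cong₂ ℕ._+_ (matches-10 (append 1F L (blocks10 L t)) w ∣w∣≤L)
        (trans (occurrences-▹1 b (value w) (inW w))
          (occurrences-block (value w) (inW w) ∣w∣≤L (blocks10 L t))) ⟩
  i ℕ.+ (o ℕ.+ occurrences (blocks10 L t) (value w))
    ≡⟨ cong (λ z → i ℕ.+ (o ℕ.+ z)) (occurrences-blocks10 L t w ∣w∣≤L) ⟩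
  i ℕ.+ (o ℕ.+ t ℕ.* (o ℕ.+ i))
    ≡⟨ ℕ.+-assoc i o _ ⟨
  i ℕ.+ o ℕ.+ t ℕ.* (o ℕ.+ i)
    ≡⟨ cong (ℕ._+ t ℕ.* (o ℕ.+ i)) (ℕ.+-comm i o) ⟩
  o ℕ.+ i ℕ.+ t ℕ.* (o ℕ.+ i) ∎
  where
  open ≡-Reasoning
  b = block L (blocks10 L t)
  i = indicator (w ≟ᵂ word10)
  o = occurrences (block L 0) (value w)

-- Carlitz' recurrences

Odd : ℕ → Set
Odd n = ¬ (2 ∣ n)

odd-1+2* : ∀ k → Odd (1 ℕ.+ k ℕ.* 2)
odd-1+2* k (ℕ.divides q eq) = contradiction
  (trans (sym (ℕ.[m+kn]%n≡m%n 1 k 2)) (trans (cong (ℕ._% 2) eq) (ℕ.m*n%n≡0 q 2))) λ ()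

odd-* : ∀ {m n} → Odd m → Odd n → Odd (m ℕ.* n)
odd-* {m} {n} m-odd n-odd 2∣mn = [ m-odd , n-odd ]′ (euclidsLemma m n prime[2] 2∣mn)

-- a and b have the same 2-adic valuation.
record _≈₂_ (a b : ℕ) : Set where
  constructor odd-multiples
  field
    u v       : ℕ
    u-odd     : Odd u
    v-odd     : Odd v
    multiples : a ℕ.* u ≡ b ℕ.* v

odd-1 : Odd 1
odd-1 = odd-1+2* 0

≈₂-refl : ∀ {a} → a ≈₂ a
≈₂-refl = odd-multiples 1 1 odd-1 odd-1 refl

≈₂-sym : ∀ {a b} → a ≈₂ b → b ≈₂ a
≈₂-sym (odd-multiples u v u-odd v-odd eq) = odd-multiples v u v-odd u-odd (sym eq)

≈₂-trans : ∀ {a b c} → a ≈₂ b → b ≈₂ c → a ≈₂ c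
≈₂-trans {a} {b} {c} (odd-multiples u v u-odd v-odd au≡bv)
  (odd-multiples u′ v′ u′-odd v′-odd bu′≡cv′) =
  odd-multiples (u ℕ.* u′) (v ℕ.* v′) (odd-* u-odd u′-odd) (odd-* v-odd v′-odd) (begin
    a ℕ.* (u ℕ.* u′)   ≡⟨ ℕ.*-assoc a u u′ ⟨
    a ℕ.* u ℕ.* u′     ≡⟨ cong (ℕ._* u′) au≡bv ⟩
    b ℕ.* v ℕ.* u′     ≡⟨ ℕ-Solver.solve 3 (λ b v u → b :* v :* u := b :* u :* v) refl b v u′ ⟩
    b ℕ.* u′ ℕ.* v     ≡⟨ cong (ℕ._* v) bu′≡cv′ ⟩
    c ℕ.* v′ ℕ.* v     ≡⟨ ℕ-Solver.solve 3 (λ c v w → c :* w :* v := c :* (v :* w)) refl c v v′ ⟩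
    c ℕ.* (v ℕ.* v′)   ∎)
  where
  open ≡-Reasoning
  open ℕ-Solver using (_:*_; _:=_)

≈₂-*ˡ : ∀ {a b} c → a ≈₂ b → (c ℕ.* a) ≈₂ (c ℕ.* b)
≈₂-*ˡ {a} {b} c (odd-multiples u v u-odd v-odd eq) = odd-multiples u v u-odd v-odd
  (trans (ℕ.*-assoc c a u) (trans (cong (c ℕ.*_) eq) (sym (ℕ.*-assoc c b v))))

odd*≈₂ : ∀ {u} a → Odd u → (u ℕ.* a) ≈₂ a
odd*≈₂ {u} a u-odd = odd-multiples 1 u odd-1 u-odd (trans (ℕ.*-identityʳ _) (ℕ.*-comm u a))

-- Induction on `j`: by Euclid's lemma one factor 2 divides `a`, and it is cancelled on both sides.
∣*odd⇒∣ : ∀ j {a u} → Odd u → 2 ℕ.^ j ∣ a ℕ.* u → 2 ℕ.^ j ∣ a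
∣*odd⇒∣ zero    {a} _ _ = ℕ.1∣ a
∣*odd⇒∣ (suc j) {a} {u} u-odd 2ʲ⁺¹∣au
  with euclidsLemma a u prime[2] (ℕ.∣-trans (ℕ.m∣m*n (2 ℕ.^ j)) 2ʲ⁺¹∣au)
... | inj₂ 2∣u = contradiction 2∣u u-odd
... | inj₁ (ℕ.divides b refl) = subst (_∣ b ℕ.* 2) (ℕ.*-comm (2 ℕ.^ j) 2)
  (ℕ.*-monoˡ-∣ {2 ℕ.^ j} {b} 2 (∣*odd⇒∣ j u-odd (ℕ.*-cancelˡ-∣ 2 (subst (2 ℕ.^ suc j ∣_)
    (ℕ-Solver.solve 2 (λ b u → b :* con 2 :* u := con 2 :* (b :* u)) refl b u) 2ʲ⁺¹∣au))))
  where open ℕ-Solver using (_:*_; _:=_; con)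

≈₂⇒∣ : ∀ j {a b} → a ≈₂ b → 2 ℕ.^ j ∣ a → 2 ℕ.^ j ∣ b
≈₂⇒∣ j {a} (odd-multiples u v _ v-odd eq) 2ʲ∣a =
  ∣*odd⇒∣ j v-odd (subst (2 ℕ.^ j ∣_) eq (ℕ.∣m⇒∣m*n u 2ʲ∣a))

[ν₂_≡_] : ℕ → ℕ → ℕ
[ν₂ a ≡ j ] = indicator (ν₂[ a ]≡? j)

≈₂⇒ν₂ : ∀ {a b} → a ≈₂ b → ∀ j → [ν₂ a ≡ j ] ≡ [ν₂ b ≡ j ]
≈₂⇒ν₂ {a} {b} a≈b j = indicator-cong (ν₂[ a ]≡? j) (ν₂[ b ]≡? j) (transfer a≈b)
  (transfer (≈₂-sym a≈b))
  where
  transfer : ∀ {a b} → a ≈₂ b → ν₂[ a ]≡ j → ν₂[ b ]≡ j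
  transfer a≈b (2ʲ∣a , 2ʲ⁺¹∤a) = ≈₂⇒∣ j a≈b 2ʲ∣a , λ 2ʲ⁺¹∣b →
      2ʲ⁺¹∤a (≈₂⇒∣ (suc j) (≈₂-sym a≈b) 2ʲ⁺¹∣b)

-- Multiplication by x of a generating function with coefficients in ℕ.
delay : (ℕ → ℕ) → ℕ → ℕ
delay f zero    = 0
delay f (suc j) = f j

ν₂-double : ∀ a j → [ν₂ 2 ℕ.* a ≡ j ] ≡ delay [ν₂ a ≡_] j
ν₂-double a zero    = indicator-no (ν₂[ 2 ℕ.* a ]≡? 0) (λ (_ , 2∤2a) → 2∤2a (ℕ.m∣m*n a))
ν₂-double a (suc j) = indicator-cong (ν₂[ 2 ℕ.* a ]≡? suc j) (ν₂[ a ]≡? j)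
  (λ (d , nd) → ℕ.*-cancelˡ-∣ 2 d , λ d′ → nd (ℕ.*-monoʳ-∣ 2 d′))
  (λ (d , nd) → ℕ.*-monoʳ-∣ 2 d , λ d′ → nd (ℕ.*-cancelˡ-∣ 2 d′))

-- Binomial coefficients up to odd factors

absorption : ∀ n k → (suc n C suc k) ℕ.* suc k ≡ suc n ℕ.* (n C k)
absorption zero    zero    = refl
absorption zero    (suc k) = refl
absorption (suc n) zero    = trans (ℕ.*-identityʳ _)
  (trans (nC1≡n (2 ℕ.+ n)) (sym (ℕ.*-identityʳ (2 ℕ.+ n))))
absorption (suc n) (suc k) = begin
  (suc (suc n) C suc (suc k)) ℕ.* (2 ℕ.+ k)
    ≡⟨ cong (ℕ._* (2 ℕ.+ k)) (nCk+nC[k+1]≡[n+1]C[k+1] (suc n) (suc k)) ⟨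
  (x ℕ.+ y) ℕ.* (2 ℕ.+ k)
    ≡⟨ ℕ-Solver.solve 3 (λ x y k → (x :+ y) :* (con 2 :+ k) :=
      x :* (con 1 :+ k) :+ x :+ y :* (con 2 :+ k)) refl x y k ⟩
  x ℕ.* suc k ℕ.+ x ℕ.+ y ℕ.* (2 ℕ.+ k)
    ≡⟨ cong₂ (λ p q → p ℕ.+ x ℕ.+ q) (absorption n k) (absorption n (suc k)) ⟩
  suc n ℕ.* (n C k) ℕ.+ x ℕ.+ suc n ℕ.* (n C suc k)
    ≡⟨ ℕ-Solver.solve 4 (λ n x p q → (con 1 :+ n) :* p :+ x :+ (con 1 :+ n) :* q :=
      x :+ (con 1 :+ n) :* (p :+ q))
         refl n x (n C k) (n C suc k) ⟩
  x ℕ.+ suc n ℕ.* (n C k ℕ.+ n C suc k)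
    ≡⟨ cong (λ z → x ℕ.+ suc n ℕ.* z) (nCk+nC[k+1]≡[n+1]C[k+1] n k) ⟩
  (2 ℕ.+ n) ℕ.* x ∎
  where
  open ≡-Reasoning
  open ℕ-Solver using (_:+_; _:*_; _:=_; con)
  x = suc n C suc k
  y = suc n C suc (suc k)

absorption₂ : ∀ n k → (suc (suc n) C suc (suc k)) ℕ.* (suc k ℕ.* (2 ℕ.+ k)) ≡
  suc n ℕ.* (2 ℕ.+ n) ℕ.* (n C k)
absorption₂ n k = begin
  (suc (suc n) C suc (suc k)) ℕ.* (suc k ℕ.* (2 ℕ.+ k))
    ≡⟨ ℕ-Solver.solve 3 (λ z a b → z :* (a :* b) := z :* b :* a) refl (suc (suc n) C suc (suc k))
      (suc k) (2 ℕ.+ k) ⟩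
  (suc (suc n) C suc (suc k)) ℕ.* (2 ℕ.+ k) ℕ.* suc k
    ≡⟨ cong (ℕ._* suc k) (absorption (suc n) (suc k)) ⟩
  (2 ℕ.+ n) ℕ.* (suc n C suc k) ℕ.* suc k
    ≡⟨ ℕ.*-assoc (2 ℕ.+ n) (suc n C suc k) (suc k) ⟩
  (2 ℕ.+ n) ℕ.* ((suc n C suc k) ℕ.* suc k)
    ≡⟨ cong ((2 ℕ.+ n) ℕ.*_) (absorption n k) ⟩
  (2 ℕ.+ n) ℕ.* (suc n ℕ.* (n C k))
    ≡⟨ ℕ-Solver.solve 3 (λ a b z → b :* (a :* z) := a :* b :* z) refl (suc n) (2 ℕ.+ n) (n C k) ⟩
  suc n ℕ.* (2 ℕ.+ n) ℕ.* (n C k) ∎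
  where
  open ≡-Reasoning
  open ℕ-Solver using (_:*_; _:=_)

-- In a (2k+1)(2k+2) = w (2n+2) b the even factors cancel against (k+1) c = (n+1) d.
cancel-even : ∀ n k {a b c d w} → Odd w →
  a ℕ.* ((1 ℕ.+ k ℕ.* 2) ℕ.* (suc k ℕ.* 2)) ≡ w ℕ.* (suc n ℕ.* 2) ℕ.* b →
  c ℕ.* suc k ≡ suc n ℕ.* d → b ≈₂ d → a ≈₂ c
cancel-even n k {a} {b} {c} {d} {w} w-odd a≡b c≡d (odd-multiples u v u-odd v-odd bu≡dv) =
  odd-multiples ((1 ℕ.+ k ℕ.* 2) ℕ.* u) (w ℕ.* v) (odd-* (odd-1+2* k) u-odd) (odd-* w-odd v-odd)
  (ℕ.*-cancelʳ-≡ _ _ (suc k ℕ.* 2) (begin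
    a ℕ.* ((1 ℕ.+ k ℕ.* 2) ℕ.* u) ℕ.* (suc k ℕ.* 2)
      ≡⟨ ℕ-Solver.solve 4 (λ a o u e → a :* (o :* u) :* e := a :* (o :* e) :* u) refl a
        (1 ℕ.+ k ℕ.* 2) u (suc k ℕ.* 2) ⟩
    a ℕ.* ((1 ℕ.+ k ℕ.* 2) ℕ.* (suc k ℕ.* 2)) ℕ.* u
      ≡⟨ cong (ℕ._* u) a≡b ⟩
    w ℕ.* (suc n ℕ.* 2) ℕ.* b ℕ.* u
      ≡⟨ ℕ.*-assoc (w ℕ.* (suc n ℕ.* 2)) b u ⟩
    w ℕ.* (suc n ℕ.* 2) ℕ.* (b ℕ.* u)
      ≡⟨ cong (w ℕ.* (suc n ℕ.* 2) ℕ.*_) bu≡dv ⟩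
    w ℕ.* (suc n ℕ.* 2) ℕ.* (d ℕ.* v)
      ≡⟨ ℕ-Solver.solve 4 (λ w m d v → w :* (m :* con 2) :* (d :* v) :=
        m :* d :* (w :* v :* con 2)) refl w (suc n) d v ⟩
    suc n ℕ.* d ℕ.* (w ℕ.* v ℕ.* 2)
      ≡⟨ cong (ℕ._* (w ℕ.* v ℕ.* 2)) c≡d ⟨
    c ℕ.* suc k ℕ.* (w ℕ.* v ℕ.* 2)
      ≡⟨ ℕ-Solver.solve 4 (λ c k w v → c :* k :* (w :* v :* con 2) :=
        c :* (w :* v) :* (k :* con 2)) refl c (suc k) w v ⟩
    c ℕ.* (w ℕ.* v) ℕ.* (suc k ℕ.* 2) ∎))
  where
  open ≡-Reasoning
  open ℕ-Solver using (_:*_; _:=_; con)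

-- Two absorptions change the left side by (2n+1)(2n+2) / ((2k+1)(2k+2)). Up to odd factors this is
-- (n+1)/(k+1), by which one absorption changes the right side.
C-even-even : ∀ n k → (n ℕ.* 2 C k ℕ.* 2) ≈₂ (n C k)
C-even-even n       zero    = ≈₂-refl
C-even-even zero    (suc k) = ≈₂-refl
C-even-even (suc n) (suc k) = cancel-even n k (odd-1+2* n) (absorption₂ (n ℕ.* 2) (k ℕ.* 2))
  (absorption n k) (C-even-even n k)

C-odd-even : ∀ n k → (suc (n ℕ.* 2) C k ℕ.* 2) ≈₂ (n C k)
C-odd-even n       zero    = ≈₂-refl
C-odd-even zero    (suc k) = ≈₂-refl
C-odd-even (suc n) (suc k) = cancel-even n k (odd-1+2* (suc n))
  (trans (absorption₂ (suc (n ℕ.* 2)) (k ℕ.* 2))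
      (cong (ℕ._* (suc (n ℕ.* 2) C k ℕ.* 2)) (ℕ.*-comm (suc n ℕ.* 2) (1 ℕ.+ suc n ℕ.* 2))))
  (absorption n k) (C-odd-even n k)

absorption-≈₂ : ∀ n k → (suc n C suc (k ℕ.* 2)) ≈₂ (suc n ℕ.* (n C k ℕ.* 2))
absorption-≈₂ n k = odd-multiples (suc (k ℕ.* 2)) 1 (odd-1+2* k) odd-1
  (trans (absorption n (k ℕ.* 2)) (sym (ℕ.*-identityʳ _)))

C-odd-odd : ∀ n k → (suc (n ℕ.* 2) C suc (k ℕ.* 2)) ≈₂ (n C k)
C-odd-odd n k = ≈₂-trans (absorption-≈₂ (n ℕ.* 2) k)
  (≈₂-trans (odd*≈₂ _ (odd-1+2* n)) (C-even-even n k))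

even*C : ∀ n k {c} → c ≈₂ (n C k) → (suc n ℕ.* 2 ℕ.* c) ≈₂ (2 ℕ.* (suc n ℕ.* (n C k)))
even*C n k {c} c≈ = subst ((suc n ℕ.* 2 ℕ.* c) ≈₂_)
  (trans (cong (ℕ._* (n C k)) (ℕ.*-comm (suc n) 2)) (ℕ.*-assoc 2 (suc n) (n C k)))
  (≈₂-*ˡ (suc n ℕ.* 2) c≈)

-- The origin of the companion sequence: odd columns of even rows lead to the products that `psi`
-- counts, with valuation raised by one.
C-even-odd : ∀ n k → (suc n ℕ.* 2 C suc (k ℕ.* 2)) ≈₂ (2 ℕ.* (suc n ℕ.* (n C k)))
C-even-odd n k = ≈₂-trans (absorption-≈₂ (suc (n ℕ.* 2)) k) (even*C n k (C-odd-even n k))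

-- Summing over the rows of Pascal's triangle

sumTo-+ : ∀ f g n → sumTo n (λ i → f i ℕ.+ g i) ≡ sumTo n f ℕ.+ sumTo n g
sumTo-+ f g zero    = refl
sumTo-+ f g (suc n) = trans (cong (ℕ._+ (f n ℕ.+ g n)) (sumTo-+ f g n))
  (ℕ-Solver.solve 4 (λ a b c d → a :+ b :+ (c :+ d) := a :+ c :+ (b :+ d)) refl (sumTo n f)
      (sumTo n g) (f n) (g n))
  where open ℕ-Solver using (_:+_; _:=_)

sumTo-pairs : ∀ f n → sumTo (n ℕ.* 2) f ≡ sumTo n (λ k → f (k ℕ.* 2) ℕ.+ f (suc (k ℕ.* 2)))
sumTo-pairs f zero    = refl
sumTo-pairs f (suc n) = trans (ℕ.+-assoc (sumTo (n ℕ.* 2) f) (f (n ℕ.* 2)) (f (suc (n ℕ.* 2))))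
  (cong (ℕ._+ (f (n ℕ.* 2) ℕ.+ f (suc (n ℕ.* 2)))) (sumTo-pairs f n))

sumTo-delay : ∀ (f : ℕ → ℕ → ℕ) n j → sumTo n (λ k → delay (f k) j) ≡
  delay (λ i → sumTo n (λ k → f k i)) j
sumTo-delay f n (suc j) = refl
sumTo-delay f zero    zero = refl
sumTo-delay f (suc n) zero = trans (ℕ.+-identityʳ _) (sumTo-delay f n zero)

theta : ℕ → ℕ → ℕ
theta n j = sumTo (suc n) (λ k → [ν₂ n C k ≡ j ])

-- The companion sequence of Carlitz' recurrences, shifted so that it vanishes at n = 0.
psi : ℕ → ℕ → ℕ
psi zero    j = 0
psi (suc n) j = sumTo (suc n) (λ k → [ν₂ suc n ℕ.* (n C k) ≡ j ])

ϑ₂≡theta : ∀ j n → ϑ₂ j n ≡ theta n j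
ϑ₂≡theta j n = length-filter-upTo (λ t → ν₂[ n C t ]≡? j) (suc n)

theta-▹1 : ∀ n j → theta (n ▹ 1F) j ≡ theta n j ℕ.+ theta n j
theta-▹1 n j = trans (sumTo-pairs (λ k → [ν₂ (n ▹ 1F) C k ≡ j ]) (suc n))
  (trans (sumTo-cong (suc n) (λ k _ → cong₂ ℕ._+_ (≈₂⇒ν₂ (C-odd-even n k) j)
      (≈₂⇒ν₂ (C-odd-odd n k) j)))
    (sumTo-+ (λ k → [ν₂ n C k ≡ j ]) (λ k → [ν₂ n C k ≡ j ]) (suc n)))

psi-double : ∀ n (f : ℕ → ℕ) j → (∀ k → f k ≈₂ (2 ℕ.* (suc n ℕ.* (n C k)))) →
             sumTo (suc n) (λ k → [ν₂ f k ≡ j ]) ≡ delay (psi (suc n)) j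
psi-double n f j f≈ = trans
  (sumTo-cong (suc n) (λ k _ → trans (≈₂⇒ν₂ (f≈ k) j) (ν₂-double (suc n ℕ.* (n C k)) j)))
  (sumTo-delay (λ k → [ν₂ suc n ℕ.* (n C k) ≡_]) (suc n) j)

delay-0 : ∀ j → delay (λ _ → 0) j ≡ 0
delay-0 zero    = refl
delay-0 (suc j) = refl

-- Even columns give `theta n` by `C-even-even`, odd columns the delayed `psi n` by `C-even-odd`.
-- There is one more even column than odd ones, so the last entry is moved to the even sum.
theta-▹0 : ∀ n j → theta (n ▹ 0F) j ≡ theta n j ℕ.+ delay (psi n) j
theta-▹0 zero j = sym (trans (cong (theta 0 j ℕ.+_) (delay-0 j)) (ℕ.+-identityʳ _))
theta-▹0 n@(suc m) j = begin
  sumTo (n ℕ.* 2) f ℕ.+ f (n ℕ.* 2)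
    ≡⟨ cong (ℕ._+ f (n ℕ.* 2)) (sumTo-pairs f n) ⟩
  sumTo n (λ k → f (k ℕ.* 2) ℕ.+ f (suc (k ℕ.* 2))) ℕ.+ f (n ℕ.* 2)
    ≡⟨ cong (ℕ._+ f (n ℕ.* 2)) (sumTo-+ (λ k → f (k ℕ.* 2)) (λ k → f (suc (k ℕ.* 2))) n) ⟩
  sumTo n (λ k → f (k ℕ.* 2)) ℕ.+ sumTo n (λ k → f (suc (k ℕ.* 2))) ℕ.+ f (n ℕ.* 2)
    ≡⟨ ℕ-Solver.solve 3 (λ a b c → a :+ b :+ c := a :+ c :+ b) refl
         (sumTo n (λ k → f (k ℕ.* 2))) (sumTo n (λ k → f (suc (k ℕ.* 2)))) (f (n ℕ.* 2)) ⟩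
  sumTo (suc n) (λ k → f (k ℕ.* 2)) ℕ.+ sumTo n (λ k → f (suc (k ℕ.* 2)))
    ≡⟨ cong₂ ℕ._+_ (sumTo-cong (suc n) (λ k _ → ≈₂⇒ν₂ (C-even-even n k) j))
                   (psi-double m (λ k → n ℕ.* 2 C suc (k ℕ.* 2)) j (C-even-odd m)) ⟩
  theta n j ℕ.+ delay (psi n) j ∎
  where
  open ≡-Reasoning
  open ℕ-Solver using (_:+_; _:=_)
  f : ℕ → ℕ
  f k = [ν₂ n ℕ.* 2 C k ≡ j ]

-- Here the factor 2n multiplies the binomials of the odd row 2n - 1, where both column parities
-- reduce to the same binomial; hence the two equal summands.
psi-▹0 : ∀ n j → psi (n ▹ 0F) j ≡ delay (psi n) j ℕ.+ delay (psi n) j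
psi-▹0 zero j = sym (cong₂ ℕ._+_ (delay-0 j) (delay-0 j))
psi-▹0 n@(suc m) j = trans (sumTo-pairs (λ k → [ν₂ n ℕ.* 2 ℕ.* (suc (m ℕ.* 2) C k) ≡ j ]) n)
  (trans (sumTo-+ (λ k → [ν₂ f k ≡ j ]) (λ k → [ν₂ g k ≡ j ]) n)
    (cong₂ ℕ._+_ (psi-double m f j (λ k → even*C m k (C-odd-even m k)))
                 (psi-double m g j (λ k → even*C m k (C-odd-odd m k)))))
  where
  f g : ℕ → ℕ
  f k = n ℕ.* 2 ℕ.* (suc (m ℕ.* 2) C k ℕ.* 2)
  g k = n ℕ.* 2 ℕ.* (suc (m ℕ.* 2) C suc (k ℕ.* 2))

psi-▹1 : ∀ n j → psi (n ▹ 1F) j ≡ theta (n ▹ 0F) j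
psi-▹1 n j = sumTo-cong (suc (n ℕ.* 2)) (λ k _ → ≈₂⇒ν₂ (odd*≈₂ (n ℕ.* 2 C k) (odd-1+2* n)) j)

open +-*-Solver using (solve; _:=_; _:+_; _:*_; _:-_; :-_; con)

-- Polynomial functions of one variable

fromℕ-homo-+ : ∀ m n → fromℕ (m ℕ.+ n) ≡ fromℕ m + fromℕ n
fromℕ-homo-+ zero    n = sym (ℚ.+-identityˡ _)
fromℕ-homo-+ (suc m) n =
  trans (cong (_+_ 1ℚ) (fromℕ-homo-+ m n)) (sym (ℚ.+-assoc 1ℚ (fromℕ m) (fromℕ n)))

fromℕ-homo-* : ∀ m n → fromℕ (m ℕ.* n) ≡ fromℕ m * fromℕ n
fromℕ-homo-* zero    n = sym (ℚ.*-zeroˡ (fromℕ n))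
fromℕ-homo-* (suc m) n =
  trans (fromℕ-homo-+ n (m ℕ.* n))
    (trans (cong (_+_ (fromℕ n)) (fromℕ-homo-* m n))
      (solve 2 (λ x y → y :+ x :* y := (con 1ℚ :+ x) :* y) refl (fromℕ m) (fromℕ n)))

/1≡fromℕ : ∀ n → + n / 1 ≡ fromℕ n
/1≡fromℕ n = trans (sym (ℚ.fromℚᵘ-cong (toℚᵘ-fromℕ n))) (ℚ.fromℚᵘ-toℚᵘ (fromℕ n))

0≤fromℕ : ∀ n → 0ℚ ≤ fromℕ n
0≤fromℕ zero    = ℚ.≤-refl
0≤fromℕ (suc n) = ℚ.+-mono-≤ (ℚ.nonNegative⁻¹ 1ℚ) (0≤fromℕ n)

0<fromℕ-suc : ∀ n → 0ℚ < fromℕ (suc n)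
0<fromℕ-suc n = ℚ.+-mono-<-≤ (ℚ.positive⁻¹ 1ℚ) (0≤fromℕ n)

pos*≡0⇒≡0 : ∀ {p q} → 0ℚ < p → p * q ≡ 0ℚ → q ≡ 0ℚ
pos*≡0⇒≡0 {p} {q} 0<p pq≡0 = begin
  q                        ≡⟨ ℚ.*-identityˡ q ⟨
  1ℚ * q                   ≡⟨ cong (_* q) (Convergence.*-recip p 0<p) ⟨
  p * recip p * q          ≡⟨ solve 3 (λ p r q → p :* r :* q := r :* (p :* q)) refl p (recip p) q ⟩
  recip p * (p * q)        ≡⟨ cong (recip p *_) pq≡0 ⟩
  recip p * 0ℚ             ≡⟨ ℚ.*-zeroʳ (recip p) ⟩
  0ℚ                       ∎
  where open ≡-Reasoning

pos*-cancelˡ : ∀ p {q r} → 0ℚ < p → p * q ≡ p * r → q ≡ r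
pos*-cancelˡ p {q} {r} 0<p pq≡pr = begin
  q             ≡⟨ solve 2 (λ q r → q := (q :- r) :+ r) refl q r ⟩
  (q - r) + r   ≡⟨ cong (_+ r) (pos*≡0⇒≡0 0<p (begin
    p * (q - r)     ≡⟨ solve 3 (λ p q r → p :* (q :- r) := p :* q :- p :* r) refl p q r ⟩
    p * q - p * r   ≡⟨ cong (_- p * r) pq≡pr ⟩
    p * r - p * r   ≡⟨ ℚ.+-inverseʳ (p * r) ⟩
    0ℚ              ∎)) ⟩
  0ℚ + r        ≡⟨ ℚ.+-identityˡ r ⟩
  r             ∎
  where open ≡-Reasoning

0<fromℕ : ∀ n → 0 ℕ.< n → 0ℚ < fromℕ n
0<fromℕ (suc n) _ = 0<fromℕ-suc n

⟦_⟧ : List ℚ → ℚ → ℚ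
⟦ [] ⟧    x = 0ℚ
⟦ a ∷ p ⟧ x = a + x * ⟦ p ⟧ x

infixl 6 _⊕_
_⊕_ : List ℚ → List ℚ → List ℚ
[]      ⊕ q       = q
(a ∷ p) ⊕ []      = a ∷ p
(a ∷ p) ⊕ (b ∷ q) = (a + b) ∷ (p ⊕ q)

⟦⊕⟧ : ∀ p q x → ⟦ p ⊕ q ⟧ x ≡ ⟦ p ⟧ x + ⟦ q ⟧ x
⟦⊕⟧ []      q       x = sym (ℚ.+-identityˡ _)
⟦⊕⟧ (a ∷ p) []      x = sym (ℚ.+-identityʳ _)
⟦⊕⟧ (a ∷ p) (b ∷ q) x = trans (cong (λ z → a + b + x * z) (⟦⊕⟧ p q x))
  (solve 5 (λ a b x p q → a :+ b :+ x :* (p :+ q) := (a :+ x :* p) :+ (b :+ x :* q))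
    refl a b x (⟦ p ⟧ x) (⟦ q ⟧ x))

infixl 7 _⊗_
_⊗_ : List ℚ → List ℚ → List ℚ
scale : ℚ → List ℚ → List ℚ
scale c []      = []
scale c (a ∷ p) = c * a ∷ scale c p
[]      ⊗ q = []
(a ∷ p) ⊗ q = scale a q ⊕ (0ℚ ∷ p ⊗ q)

⟦scale⟧ : ∀ c p x → ⟦ scale c p ⟧ x ≡ c * ⟦ p ⟧ x
⟦scale⟧ c []      x = sym (ℚ.*-zeroʳ c)
⟦scale⟧ c (a ∷ p) x = trans (cong (λ z → c * a + x * z) (⟦scale⟧ c p x))
  (solve 4 (λ c a x p → c :* a :+ x :* (c :* p) := c :* (a :+ x :* p)) refl c a x (⟦ p ⟧ x))

⟦⊗⟧ : ∀ p q x → ⟦ p ⊗ q ⟧ x ≡ ⟦ p ⟧ x * ⟦ q ⟧ x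
⟦⊗⟧ []      q x = sym (ℚ.*-zeroˡ (⟦ q ⟧ x))
⟦⊗⟧ (a ∷ p) q x = trans (⟦⊕⟧ (scale a q) (0ℚ ∷ p ⊗ q) x)
  (trans (cong₂ (λ y z → y + (0ℚ + x * z)) (⟦scale⟧ a q x) (⟦⊗⟧ p q x))
    (solve 4 (λ a x p q → a :* q :+ (con 0ℚ :+ x :* (p :* q)) := (a :+ x :* p) :* q)
      refl a x (⟦ p ⟧ x) (⟦ q ⟧ x)))

-- Synthetic division: the intermediate values of Horner's scheme at `r` are the coefficients of the
-- quotient.
quotient : ∀ p r → ∃[ q ] length q ≡ ℕ.pred (length p) ×
           (∀ x → ⟦ p ⟧ x ≡ ⟦ p ⟧ r + (x - r) * ⟦ q ⟧ x)
quotient [] r = [] , refl , λ x →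
  solve 2 (λ x r → con 0ℚ := con 0ℚ :+ (x :- r) :* con 0ℚ) refl x r
quotient (a ∷ []) r = [] , refl , λ x →
  solve 3 (λ a x r → a :+ x :* con 0ℚ := a :+ r :* con 0ℚ :+ (x :- r) :* con 0ℚ) refl a x r
quotient (a ∷ p@(_ ∷ _)) r with quotient p r
... | q , len , eq = ⟦ p ⟧ r ∷ q , cong suc len , λ x →
  trans (cong (λ z → a + x * z) (eq x))
    (solve 5 (λ a x r p q → a :+ x :* (p :+ (x :- r) :* q) :=
                            a :+ r :* p :+ (x :- r) :* (p :+ x :* q))
      refl a x r (⟦ p ⟧ r) (⟦ q ⟧ x))

fromℕ-minus : ∀ {m n} → m ℕ.≤ n → fromℕ n - fromℕ m ≡ fromℕ (n ℕ.∸ m)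
fromℕ-minus {m} {n} m≤n = begin
  fromℕ n - fromℕ m                       ≡⟨ cong (λ k → fromℕ k - fromℕ m) (ℕ.m+[n∸m]≡n m≤n) ⟨
  fromℕ (m ℕ.+ (n ℕ.∸ m)) - fromℕ m       ≡⟨ cong (_- fromℕ m) (fromℕ-homo-+ m (n ℕ.∸ m)) ⟩
  fromℕ m + fromℕ (n ℕ.∸ m) - fromℕ m     ≡⟨ solve 2 (λ x y → x :+ y :- x := y) refl (fromℕ m)
      (fromℕ (n ℕ.∸ m)) ⟩
  fromℕ (n ℕ.∸ m)                         ∎
  where open ≡-Reasoning

0<fromℕ-minus : ∀ {m n} → m ℕ.< n → 0ℚ < fromℕ n - fromℕ m
0<fromℕ-minus {m} {n} m<n = subst (0ℚ <_) (sym (fromℕ-minus (ℕ.<⇒≤ m<n)))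
  (0<fromℕ (n ℕ.∸ m) (ℕ.m<n⇒0<n∸m m<n))

-- Each factor x − n lowers the degree, and the quotient still vanishes beyond n.
infinitely-many-roots⇒0 : ∀ d p → length p ℕ.≤ d → ∀ n →
  (∀ t → n ℕ.≤ t → ⟦ p ⟧ (fromℕ t) ≡ 0ℚ) → ∀ x → ⟦ p ⟧ x ≡ 0ℚ
infinitely-many-roots⇒0 zero    []      _   n roots x = refl
infinitely-many-roots⇒0 (suc d) p       p≤d n roots x with quotient p (fromℕ n)
... | q , len , eq = begin
  ⟦ p ⟧ x                                      ≡⟨ eq x ⟩
  ⟦ p ⟧ (fromℕ n) + (x - fromℕ n) * ⟦ q ⟧ x    ≡⟨ cong₂ (λ y z → y + (x - fromℕ n) * z)
      (roots n ℕ.≤-refl) q≡0 ⟩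
  0ℚ + (x - fromℕ n) * 0ℚ                      ≡⟨ solve 1 (λ z → con 0ℚ :+ z :* con 0ℚ :=
      con 0ℚ) refl (x - fromℕ n) ⟩
  0ℚ                                           ∎
  where
  open ≡-Reasoning
  q≡0 : ⟦ q ⟧ x ≡ 0ℚ
  q≡0 = infinitely-many-roots⇒0 d q (ℕ.≤-trans (ℕ.≤-reflexive len) (ℕ.pred-mono-≤ p≤d))
    (suc n) (λ t n<t → pos*≡0⇒≡0 (0<fromℕ-minus n<t) (begin
      (fromℕ t - fromℕ n) * ⟦ q ⟧ (fromℕ t)
        ≡⟨ ℚ.+-identityˡ _ ⟨
      0ℚ + (fromℕ t - fromℕ n) * ⟦ q ⟧ (fromℕ t)
        ≡⟨ cong (_+ (fromℕ t - fromℕ n) * ⟦ q ⟧ (fromℕ t)) (roots n ℕ.≤-refl) ⟨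
      ⟦ p ⟧ (fromℕ n) + (fromℕ t - fromℕ n) * ⟦ q ⟧ (fromℕ t)
        ≡⟨ eq (fromℕ t) ⟨
      ⟦ p ⟧ (fromℕ t)
        ≡⟨ roots t (ℕ.<⇒≤ n<t) ⟩
      0ℚ ∎)) x

-- f is a polynomial function with 1-jet c₀ + c₁ x at 0.
record Jet (f : ℕ → ℚ) (c₀ c₁ : ℚ) : Set where
  constructor _,_
  field
    higher    : List ℚ
    expansion : ∀ t → f t ≡ ⟦ c₀ ∷ c₁ ∷ higher ⟧ (fromℕ t)

jet-cong : ∀ {f g c₀ c₁} → (∀ t → f t ≡ g t) → Jet f c₀ c₁ → Jet g c₀ c₁
jet-cong f≗g (q , eq) = q , λ t → trans (sym (f≗g t)) (eq t)

jet-constant : ∀ c → Jet (λ _ → c) c 0ℚ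
jet-constant c = [] , λ t →
  solve 2 (λ c x → c := c :+ x :* (con 0ℚ :+ x :* con 0ℚ)) refl c (fromℕ t)

jet-identity : Jet fromℕ 0ℚ 1ℚ
jet-identity = [] , λ t →
  solve 1 (λ x → x := con 0ℚ :+ x :* (con 1ℚ :+ x :* con 0ℚ)) refl (fromℕ t)

jet-+ : ∀ {f g c₀ c₁ d₀ d₁} → Jet f c₀ c₁ → Jet g d₀ d₁ →
        Jet (λ t → f t + g t) (c₀ + d₀) (c₁ + d₁)
jet-+ {c₀ = c₀} {c₁} {d₀} {d₁} (p , f≡) (q , g≡) = p ⊕ q , λ t →
  trans (cong₂ _+_ (f≡ t) (g≡ t)) (sym (⟦⊕⟧ (c₀ ∷ c₁ ∷ p) (d₀ ∷ d₁ ∷ q) (fromℕ t)))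

jet-* : ∀ {f g c₀ c₁ d₀ d₁} → Jet f c₀ c₁ → Jet g d₀ d₁ →
        Jet (λ t → f t * g t) (c₀ * d₀) (c₀ * d₁ + c₁ * d₀)
jet-* {c₀ = c₀} {c₁} {d₀} {d₁} (p , f≡) (q , g≡) =
  -- The terms of (c₀ + c₁ x + p x²)(d₀ + d₁ x + q x²) divisible by x², grouped by whether both
  -- factors, or only one, contribute an x.
  scale c₀ q ⊕ (c₁ ∷ p) ⊗ (d₁ ∷ q) ⊕ scale d₀ p , λ t → let x = fromℕ t in
  trans (cong₂ _*_ (f≡ t) (g≡ t)) (sym (trans
    (cong (λ z → c₀ * d₀ + x * (c₀ * d₁ + c₁ * d₀ + x * z))
      (trans (⟦⊕⟧ (scale c₀ q ⊕ (c₁ ∷ p) ⊗ (d₁ ∷ q)) (scale d₀ p) x)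
        (cong₂ _+_ (trans (⟦⊕⟧ (scale c₀ q) ((c₁ ∷ p) ⊗ (d₁ ∷ q)) x)
                     (cong₂ _+_ (⟦scale⟧ c₀ q x) (⟦⊗⟧ (c₁ ∷ p) (d₁ ∷ q) x)))
                   (⟦scale⟧ d₀ p x))))
    (solve 7 (λ x c₀ c₁ d₀ d₁ p q →
       c₀ :* d₀ :+ x :* (c₀ :* d₁ :+ c₁ :* d₀ :+
         x :* (c₀ :* q :+ (c₁ :+ x :* p) :* (d₁ :+ x :* q) :+ d₀ :* p)) :=
       (c₀ :+ x :* (c₁ :+ x :* p)) :* (d₀ :+ x :* (d₁ :+ x :* q)))
      refl x c₀ c₁ d₀ d₁ (⟦ p ⟧ x) (⟦ q ⟧ x))))

jet-value : ∀ {f c₀ c₁} → Jet f c₀ c₁ → f 0 ≡ c₀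
jet-value {c₀ = c₀} {c₁} (q , eq) = trans (eq 0)
  (solve 2 (λ c z → c :+ con 0ℚ :* z := c) refl c₀ (c₁ + 0ℚ * ⟦ q ⟧ 0ℚ))

-- At t = 0 the constant terms agree. For t ≥ 1 a factor t cancels from the difference, so `r` has
-- infinitely many roots and vanishes at 0 too, where its value is c₁ - d₁.
jet-unique : ∀ {f c₀ c₁ d₀ d₁} → Jet f c₀ c₁ → Jet f d₀ d₁ → c₁ ≡ d₁
jet-unique {f} {c₀} {c₁} {d₀} {d₁} (p , p≡) (q , q≡) = begin
  c₁                 ≡⟨ solve 2 (λ c d → c := (c :- d) :+ d) refl c₁ d₁ ⟩
  (c₁ - d₁) + d₁     ≡⟨ cong (_+ d₁) (trans at-0
      (infinitely-many-roots⇒0 _ r ℕ.≤-refl 1 roots 0ℚ)) ⟩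
  0ℚ + d₁            ≡⟨ ℚ.+-identityˡ d₁ ⟩
  d₁                 ∎
  where
  open ≡-Reasoning
  c₀≡d₀ : c₀ ≡ d₀
  c₀≡d₀ = trans (sym (jet-value {f} {c₁ = c₁} (p , p≡))) (jet-value {f} {c₁ = d₁} (q , q≡))
  r : List ℚ
  r = (c₁ ∷ p) ⊕ scale (- 1ℚ) (d₁ ∷ q)
  ⟦r⟧ : ∀ x → ⟦ r ⟧ x ≡ ⟦ c₁ ∷ p ⟧ x - ⟦ d₁ ∷ q ⟧ x
  ⟦r⟧ x = trans (⟦⊕⟧ (c₁ ∷ p) (scale (- 1ℚ) (d₁ ∷ q)) x)
    (trans (cong (_+_ (⟦ c₁ ∷ p ⟧ x)) (⟦scale⟧ (- 1ℚ) (d₁ ∷ q) x))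
      (solve 2 (λ y z → y :+ con (- 1ℚ) :* z := y :- z) refl (⟦ c₁ ∷ p ⟧ x) (⟦ d₁ ∷ q ⟧ x)))
  at-0 : c₁ - d₁ ≡ ⟦ r ⟧ 0ℚ
  at-0 = sym (trans (⟦r⟧ 0ℚ)
    (solve 4 (λ c d y z → (c :+ con 0ℚ :* y) :- (d :+ con 0ℚ :* z) := c :- d)
      refl c₁ d₁ (⟦ p ⟧ 0ℚ) (⟦ q ⟧ 0ℚ)))
  roots : ∀ t → 1 ℕ.≤ t → ⟦ r ⟧ (fromℕ t) ≡ 0ℚ
  roots (suc t) _ = pos*≡0⇒≡0 (0<fromℕ-suc t) (begin
    x * ⟦ r ⟧ x
      ≡⟨ cong (x *_) (⟦r⟧ x) ⟩
    x * (⟦ c₁ ∷ p ⟧ x - ⟦ d₁ ∷ q ⟧ x)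
      ≡⟨ solve 4 (λ c x y z → x :* (y :- z) := (c :+ x :* y) :- (c :+ x :* z))
           refl c₀ x (⟦ c₁ ∷ p ⟧ x) (⟦ d₁ ∷ q ⟧ x) ⟩
    ⟦ c₀ ∷ c₁ ∷ p ⟧ x - (c₀ + x * ⟦ d₁ ∷ q ⟧ x)
      ≡⟨ cong (λ c → ⟦ c₀ ∷ c₁ ∷ p ⟧ x - (c + x * ⟦ d₁ ∷ q ⟧ x)) c₀≡d₀ ⟩
    ⟦ c₀ ∷ c₁ ∷ p ⟧ x - ⟦ d₀ ∷ d₁ ∷ q ⟧ x
      ≡⟨ cong₂ _-_ (p≡ (suc t)) (q≡ (suc t)) ⟨
    f (suc t) - f (suc t)
      ≡⟨ ℚ.+-inverseʳ (f (suc t)) ⟩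
    0ℚ ∎)
    where x = fromℕ (suc t)

-- Restriction of polynomials to a line

constantᴹ : Monomial → ℚ
constantᴹ []      = 1ℚ
constantᴹ (_ ∷ _) = 0ℚ

-- The derivative of a monomial at the origin in direction `v`; a product of two or more variables
-- has derivative 0 there.
linearᴹ : (W → ℚ) → Monomial → ℚ
linearᴹ v []      = 0ℚ
linearᴹ v (w ∷ m) = v w * constantᴹ m

constant : Polynomial → ℚ
constant []            = 0ℚ
constant ((c , m) ∷ p) = c * constantᴹ m + constant p

linear : (W → ℚ) → Polynomial → ℚ
linear v []            = 0ℚ
linear v ((c , m) ∷ p) = c * linearᴹ v m + linear v p

jet-monomial : ∀ v m → Jet (λ t → productℚ (map (λ w → fromℕ t * v w) m)) (constantᴹ m)
  (linearᴹ v m)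
jet-monomial v []      = jet-constant 1ℚ
jet-monomial v (w ∷ m) = subst₂ (Jet _)
  (solve 2 (λ a c → (con 0ℚ :* a) :* c := con 0ℚ) refl (v w) (constantᴹ m))
  (solve 3 (λ a c d → (con 0ℚ :* a) :* d :+ (con 0ℚ :* con 0ℚ :+ con 1ℚ :* a) :* c := a :* c)
    refl (v w) (constantᴹ m) (linearᴹ v m))
  (jet-* (jet-* jet-identity (jet-constant (v w))) (jet-monomial v m))

jet-eval : ∀ v p → Jet (λ t → eval p (λ w → fromℕ t * v w)) (constant p) (linear v p)
jet-eval v []            = jet-constant 0ℚ
jet-eval v ((c , m) ∷ p) = jet-+ (subst (Jet _ (c * constantᴹ m))
  (solve 3 (λ c a b → c :* b :+ con 0ℚ :* a := c :* b) refl c (constantᴹ m) (linearᴹ v m))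
  (jet-* (jet-constant c) (jet-monomial v m))) (jet-eval v p)

linearᴹ-+ : ∀ u v m → linearᴹ (λ w → u w + v w) m ≡ linearᴹ u m + linearᴹ v m
linearᴹ-+ u v []      = refl
linearᴹ-+ u v (w ∷ m) = ℚ.*-distribʳ-+ (constantᴹ m) (u w) (v w)

linear-+ : ∀ u v p → linear (λ w → u w + v w) p ≡ linear u p + linear v p
linear-+ u v []            = refl
linear-+ u v ((c , m) ∷ p) =
  trans (cong₂ (λ y z → c * y + z) (linearᴹ-+ u v m) (linear-+ u v p))
    (solve 5 (λ c y y′ z z′ → c :* (y :+ y′) :+ (z :+ z′) := c :* y :+ z :+ (c :* y′ :+ z′))
      refl c (linearᴹ u m) (linearᴹ v m) (linear u p) (linear v p))

basis : W → W → ℚ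
basis w u = fromℕ (indicator (u ≟ᵂ w))

exponent-∷ : ∀ w u m → exponent w (u ∷ m) ≡ indicator (w ≟ᵂ u) ℕ.+ exponent w m
exponent-∷ w u m with does (w ≟ᵂ u)
... | true  = refl
... | false = refl

exponent-head : ∀ w m → exponent w (w ∷ m) ≡ suc (exponent w m)
exponent-head w m = trans (exponent-∷ w w m) (cong (ℕ._+ exponent w m)
  (indicator-yes (w ≟ᵂ w) refl))

exponent-X≡suc⇒≡ : ∀ {u w k} → suc k ≡ exponent u (X w) → u ≡ w
exponent-X≡suc⇒≡ {u} {w} eq with u ≟ᵂ w
... | yes u≡w = u≡w
... | no  u≢w = contradiction (trans eq (trans (exponent-∷ u w [])
  (cong (ℕ._+ 0) (indicator-no (u ≟ᵂ w) u≢w)))) λ ()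

linearᴹ-basis : ∀ w m → linearᴹ (basis w) m ≡ fromℕ (indicator (m ≈ᴹ? (X w)))
linearᴹ-basis w [] = cong fromℕ (sym (indicator-no ([] ≈ᴹ? (X w)) λ { (eq ∷ []) →
  contradiction (trans eq (exponent-head w [])) λ () }))
linearᴹ-basis w (u ∷ []) with u ≟ᵂ w
... | yes refl = trans (cong (λ k → fromℕ k * 1ℚ) (indicator-yes (u ≟ᵂ u) refl))
                   (cong fromℕ (sym (indicator-yes ((X u) ≈ᴹ? (X u)) (refl ∷ refl ∷ []))))
... | no u≢w   = trans (cong (λ k → fromℕ k * 1ℚ) (indicator-no (u ≟ᵂ w) u≢w))
                   (cong fromℕ (sym (indicator-no ((X u) ≈ᴹ? (X w))
                     λ { (eq ∷ _) → u≢w (exponent-X≡suc⇒≡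
                       (trans (sym (exponent-head u [])) eq)) })))
linearᴹ-basis w (u ∷ u′ ∷ m) = trans (ℚ.*-zeroʳ (basis w u))
  (cong fromℕ (sym (indicator-no ((u ∷ u′ ∷ m) ≈ᴹ? (X w)) ≉)))
  where
  ≉ : ¬ ((u ∷ u′ ∷ m) ≈ᴹ (X w))
  -- Both leading factors have positive exponent, which forces them to equal `w`; but then the
  -- exponent of `w` is at least 2 against 1 in `X w`.
  ≉ (eq ∷ eq′ ∷ _) with u≡w ← exponent-X≡suc⇒≡ {u} {w} {exponent u (u′ ∷ m)}
      (trans (sym (exponent-head u (u′ ∷ m))) eq)
                      | u′≡w ← exponent-X≡suc⇒≡ {u′} {w} {indicator (u′ ≟ᵂ u) ℕ.+ exponent u′ m}
                                 (trans (sym (trans (exponent-∷ u′ u (u′ ∷ m))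
                                   (trans (cong (indicator (u′ ≟ᵂ u) ℕ.+_) (exponent-head u′ m))
                                     (ℕ.+-suc _ _)))) eq′)
    with refl ← u≡w | refl ← u′≡w
    = contradiction (ℕ.suc-injective (trans (trans (cong suc (sym (exponent-head u m)))
      (sym (exponent-head u (u ∷ m)))) (trans eq (exponent-head u [])))) λ ()

coefficient-X : ∀ w p → coefficient (X w) p ≡ linear (basis w) p
coefficient-X w []            = refl
coefficient-X w ((c , m) ∷ p) =
  trans (split)
    (cong₂ (λ y z → c * y + z) (sym (linearᴹ-basis w m)) (coefficient-X w p))
  where
  split : coefficient (X w) ((c , m) ∷ p) ≡
          c * fromℕ (indicator (m ≈ᴹ? (X w))) + coefficient (X w) p
  split with does (m ≈ᴹ? (X w))
  ... | true  = cong (_+ coefficient (X w) p) (sym (ℚ.*-identityʳ c))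
  ... | false = solve 2 (λ c z → z := c :* con 0ℚ :+ z) refl c (coefficient (X w) p)

maxLengthᴹ : Monomial → ℕ
maxLengthᴹ = foldr (λ w k → length (value w) ℕ.⊔ k) 0

maxLength : Polynomial → ℕ
maxLength = foldr (λ t k → maxLengthᴹ (proj₂ t) ℕ.⊔ k) 0

-- A polynomial involves finitely many words, so it suffices to know the counts of words up to a
-- bounded length.
eval-cong : ∀ {x y} L → (∀ w → length (value w) ℕ.≤ L → x w ≡ y w) →
            ∀ p → maxLength p ℕ.≤ L → eval p x ≡ eval p y
eval-cong {x} {y} L x≡y []            _   = refl
eval-cong {x} {y} L x≡y ((c , m) ∷ p) p≤L =
  cong₂ (λ a b → c * a + b) (monomial m (ℕ.m⊔n≤o⇒m≤o (maxLengthᴹ m) (maxLength p) p≤L))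
    (eval-cong L x≡y p (ℕ.m⊔n≤o⇒n≤o (maxLengthᴹ m) (maxLength p) p≤L))
  where
  monomial : ∀ m → maxLengthᴹ m ℕ.≤ L → productℚ (map x m) ≡ productℚ (map y m)
  monomial []      _   = refl
  monomial (w ∷ m) m≤L =
    cong₂ _*_ (x≡y w (ℕ.m⊔n≤o⇒m≤o (length (value w)) (maxLengthᴹ m) m≤L))
      (monomial m (ℕ.m⊔n≤o⇒n≤o (length (value w)) (maxLengthᴹ m) m≤L))

-- Generating functions

/-denominator : ∀ a b .{{_ : ℕ.NonZero b}} → fromℕ b * (+ a / b) ≡ fromℕ a
/-denominator a (suc b) = ℚ.toℚᵘ-injective (begin
  toℚᵘ (fromℕ (suc b) * (+ a / suc b))
    ≈⟨ ℚ.toℚᵘ-homo-* (fromℕ (suc b)) (+ a / suc b) ⟩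
  toℚᵘ (fromℕ (suc b)) ℚᵘ.* toℚᵘ (+ a / suc b)
    ≈⟨ ℚᵘ.*-cong (toℚᵘ-fromℕ (suc b)) (ℚ.toℚᵘ-fromℚᵘ (ℚᵘ.mkℚᵘ (+ a) b)) ⟩
  ℚᵘ.mkℚᵘ (+ suc b) 0 ℚᵘ.* ℚᵘ.mkℚᵘ (+ a) b
    ≈⟨ ℚᵘ.*≡* (trans (ℤ.*-identityʳ _) (trans (ℤ.*-comm (+ suc b) (+ a))
         (cong (λ k → + a ℤ.* + suc k) (sym (ℕ.+-identityʳ b))))) ⟩
  ℚᵘ.mkℚᵘ (+ a) 0
    ≈⟨ toℚᵘ-fromℕ a ⟨
  toℚᵘ (fromℕ a) ∎)
  where open ℚᵘ.≃-Reasoning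

0<theta₀ : ∀ n → 0 ℕ.< theta n 0
0<theta₀ n = subst (0 ℕ.<_) (sym (sumTo-suc (λ k → [ν₂ n C k ≡ 0 ]) n)) (s≤s z≤n)

-- The total `recip` allows rewriting with the recurrences without transporting proofs that the
-- denominator is nonzero.
weight : ℕ → ℚ
weight n = recip (fromℕ (theta n 0))

ϑ-series ψ-series : ℕ → PowerSeries
ϑ-series n j = fromℕ (theta n j) * weight n
ψ-series n j = fromℕ (psi n j) * weight n

fromℕ*weight : ∀ n → fromℕ (theta n 0) * weight n ≡ 1ℚ
fromℕ*weight n = *-recip (fromℕ (theta n 0)) (0<fromℕ (theta n 0) (0<theta₀ n))

ϑ₂-ratio≡ϑ-series : ∀ j n → ϑ₂-ratio j n ≡ ϑ-series n j
ϑ₂-ratio≡ϑ-series j n = pos*-cancelˡ (fromℕ (ϑ₂ 0 n))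
  (subst (λ k → 0ℚ < fromℕ k) (sym (ϑ₂≡theta 0 n)) (0<fromℕ (theta n 0) (0<theta₀ n))) (begin
  fromℕ (ϑ₂ 0 n) * ϑ₂-ratio j n
    ≡⟨ /-denominator (ϑ₂ j n) (ϑ₂ 0 n) ⟩
  fromℕ (ϑ₂ j n)
    ≡⟨ cong fromℕ (ϑ₂≡theta j n) ⟩
  fromℕ (theta n j)
    ≡⟨ ℚ.*-identityʳ _ ⟨
  fromℕ (theta n j) * 1ℚ
    ≡⟨ cong (fromℕ (theta n j) *_) (fromℕ*weight n) ⟨
  fromℕ (theta n j) * (fromℕ (theta n 0) * weight n)
    ≡⟨ solve 3 (λ a b c → a :* (b :* c) := b :* (a :* c)) refl (fromℕ (theta n j))
      (fromℕ (theta n 0)) (weight n) ⟩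
  fromℕ (theta n 0) * ϑ-series n j
    ≡⟨ cong (λ k → fromℕ k * ϑ-series n j) (ϑ₂≡theta 0 n) ⟨
  fromℕ (ϑ₂ 0 n) * ϑ-series n j ∎)
  where open ≡-Reasoning

weight-▹0 : ∀ n → weight (n ▹ 0F) ≡ weight n
weight-▹0 n = cong (λ k → recip (fromℕ k)) (trans (theta-▹0 n 0) (ℕ.+-identityʳ _))

weight-▹1 : ∀ n → weight (n ▹ 1F) ≡ ½ * weight n
weight-▹1 n = pos*-cancelˡ (fromℕ (theta (n ▹ 1F) 0))
  (0<fromℕ (theta (n ▹ 1F) 0) (0<theta₀ (n ▹ 1F))) (begin
  fromℕ (theta (n ▹ 1F) 0) * weight (n ▹ 1F)
    ≡⟨ fromℕ*weight (n ▹ 1F) ⟩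
  1ℚ
    ≡⟨ fromℕ*weight n ⟨
  fromℕ (theta n 0) * weight n
    ≡⟨ solve 2 (λ a b → a :* b := (a :+ a) :* (con ½ :* b)) refl (fromℕ (theta n 0)) (weight n) ⟩
  (fromℕ (theta n 0) + fromℕ (theta n 0)) * (½ * weight n)
    ≡⟨ cong (_* (½ * weight n)) (trans (cong fromℕ (theta-▹1 n 0))
      (fromℕ-homo-+ (theta n 0) (theta n 0))) ⟨
  fromℕ (theta (n ▹ 1F) 0) * (½ * weight n) ∎)
  where open ≡-Reasoning

x*_ : PowerSeries → PowerSeries
(x* f) zero    = 0ℚ
(x* f) (suc j) = f j

x*-cong : ∀ {f g : PowerSeries} → (∀ j → f j ≡ g j) → ∀ j → (x* f) j ≡ (x* g) j
x*-cong f≡g zero    = refl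
x*-cong f≡g (suc j) = f≡g j

delay-series : ∀ f c j → fromℕ (delay f j) * c ≡ (x* (λ i → fromℕ (f i) * c)) j
delay-series f c zero    = ℚ.*-zeroˡ c
delay-series f c (suc j) = refl

ϑ-series-▹0 : ∀ n j → ϑ-series (n ▹ 0F) j ≡ ϑ-series n j + (x* ψ-series n) j
ϑ-series-▹0 n j = trans (cong₂ (λ k w → fromℕ k * w) (theta-▹0 n j) (weight-▹0 n))
  (trans (cong (_* weight n) (fromℕ-homo-+ (theta n j) (delay (psi n) j)))
    (trans (ℚ.*-distribʳ-+ (weight n) (fromℕ (theta n j)) (fromℕ (delay (psi n) j)))
      (cong (_+_ (ϑ-series n j)) (delay-series (psi n) (weight n) j))))

ψ-series-▹0 : ∀ n j → ψ-series (n ▹ 0F) j ≡ (x* ψ-series n) j + (x* ψ-series n) j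
ψ-series-▹0 n j = trans (cong₂ (λ k w → fromℕ k * w) (psi-▹0 n j) (weight-▹0 n))
  (trans (cong (_* weight n) (fromℕ-homo-+ (delay (psi n) j) (delay (psi n) j)))
    (trans (ℚ.*-distribʳ-+ (weight n) (fromℕ (delay (psi n) j)) (fromℕ (delay (psi n) j)))
      (cong (λ z → z + z) (delay-series (psi n) (weight n) j))))

ϑ-series-▹1 : ∀ n j → ϑ-series (n ▹ 1F) j ≡ ϑ-series n j
ϑ-series-▹1 n j = trans (cong₂ (λ k w → fromℕ k * w) (theta-▹1 n j) (weight-▹1 n))
  (trans (cong (_* (½ * weight n)) (fromℕ-homo-+ (theta n j) (theta n j)))
    (solve 2 (λ a b → (a :+ a) :* (con ½ :* b) := a :* b) refl (fromℕ (theta n j)) (weight n)))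

ψ-series-▹1 : ∀ n j → ψ-series (n ▹ 1F) j ≡ ½ * (ϑ-series n j + (x* ψ-series n) j)
ψ-series-▹1 n j = begin
  fromℕ (psi (n ▹ 1F) j) * weight (n ▹ 1F)
    ≡⟨ cong₂ (λ k w → fromℕ k * w) (psi-▹1 n j) (weight-▹1 n) ⟩
  fromℕ (theta (n ▹ 0F) j) * (½ * weight n)
    ≡⟨ solve 3 (λ a h w → a :* (h :* w) := h :* (a :* w)) refl (fromℕ (theta (n ▹ 0F) j)) ½
      (weight n) ⟩
  ½ * (fromℕ (theta (n ▹ 0F) j) * weight n)
    ≡⟨ cong (λ w → ½ * (fromℕ (theta (n ▹ 0F) j) * w)) (weight-▹0 n) ⟨
  ½ * ϑ-series (n ▹ 0F) j
    ≡⟨ cong (½ *_) (ϑ-series-▹0 n j) ⟩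
  ½ * (ϑ-series n j + (x* ψ-series n) j) ∎
  where open ≡-Reasoning

-- Congruence modulo xᴸ and the block operator

infix 4 _≈[_]_
_≈[_]_ : PowerSeries → ℕ → PowerSeries → Set
f ≈[ L ] g = ∀ j → j ℕ.< L → f j ≡ g j

x*-≈ : ∀ {f g L} → f ≈[ L ] g → (x* f) ≈[ suc L ] (x* g)
x*-≈ f≈g zero    _         = refl
x*-≈ f≈g (suc j) (s≤s j<L) = f≈g j j<L

≈-weaken : ∀ {f g k L} → k ℕ.≤ L → f ≈[ L ] g → f ≈[ k ] g
≈-weaken k≤L f≈g j j<k = f≈g j (ℕ.≤-trans j<k k≤L)

State : Set
State = PowerSeries × PowerSeries

step₀ step₁ : State → State
step₀ (f , g) = (λ j → f j + (x* g) j) , (λ j → (x* g) j + (x* g) j)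
step₁ (f , g) = f , (λ j → ½ * (f j + (x* g) j))

iterate : {A : Set} → (A → A) → ℕ → A → A
iterate h zero    s = s
iterate h (suc k) s = h (iterate h k s)

_≋_ : State → State → Set
(f , g) ≋ (f′ , g′) = (∀ j → f j ≡ f′ j) × (∀ j → g j ≡ g′ j)

≋-trans : ∀ {s t u} → s ≋ t → t ≋ u → s ≋ u
≋-trans (p , q) (p′ , q′) = (λ j → trans (p j) (p′ j)) , (λ j → trans (q j) (q′ j))

step₀-cong : ∀ {s t} → s ≋ t → step₀ s ≋ step₀ t
step₀-cong (p , q) = (λ j → cong₂ _+_ (p j) (x*-cong q j)) ,
  (λ j → cong₂ _+_ (x*-cong q j) (x*-cong q j))

step₁-cong : ∀ {s t} → s ≋ t → step₁ s ≋ step₁ t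
step₁-cong (p , q) = p , (λ j → cong (½ *_) (cong₂ _+_ (p j) (x*-cong q j)))

state : ℕ → State
state n = ϑ-series n , ψ-series n

state-append-0 : ∀ k n → state (append 0F k n) ≋ iterate step₀ k (state n)
state-append-0 zero    n = (λ _ → refl) , (λ _ → refl)
state-append-0 (suc k) n = ≋-trans (ϑ-series-▹0 (append 0F k n) , ψ-series-▹0 (append 0F k n))
  (step₀-cong (state-append-0 k n))

state-append-1 : ∀ k n → state (append 1F k n) ≋ iterate step₁ k (state n)
state-append-1 zero    n = (λ _ → refl) , (λ _ → refl)
state-append-1 (suc k) n = ≋-trans (ϑ-series-▹1 (append 1F k n) , ψ-series-▹1 (append 1F k n))
  (step₁-cong (state-append-1 k n))

iterate-cong : ∀ {h} → (∀ {s t} → s ≋ t → h s ≋ h t) → ∀ k {s t} → s ≋ t →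
  iterate h k s ≋ iterate h k t
iterate-cong h-cong zero    s≋t = s≋t
iterate-cong h-cong (suc k) s≋t = h-cong (iterate-cong h-cong k s≋t)

blockState : ℕ → State → State
blockState L s = iterate step₀ L (iterate step₁ L s)

state-block : ∀ L n → state (block L n) ≋ blockState L (state n)
state-block L n = ≋-trans (state-append-0 L (append 1F L n))
  (iterate-cong step₀-cong L (state-append-1 L n))

-- After k ones the old second component survives only with a factor xᵏ.
iterate-step₁-≈ : ∀ {f f′} L k → f ≈[ L ] f′ → k ℕ.≤ L → ∀ g g′ →
  (proj₁ (iterate step₁ k (f , g)) ≈[ L ] proj₁ (iterate step₁ k (f′ , g′))) ×
  (proj₂ (iterate step₁ k (f , g)) ≈[ k ] proj₂ (iterate step₁ k (f′ , g′)))
iterate-step₁-≈ L zero    f≈f′ k≤L g g′ = f≈f′ , λ _ ()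
iterate-step₁-≈ L (suc k) f≈f′ k<L g g′ with iterate-step₁-≈ L k f≈f′ (ℕ.<⇒≤ k<L) g g′
... | f≈ , g≈ = f≈ , λ j j≤k → cong (½ *_) (cong₂ _+_ (f≈ j (ℕ.≤-trans j≤k k<L)) (x*-≈ g≈ j j≤k))

iterate-step₀-≈ : ∀ {f f′ g g′} L k → f ≈[ L ] f′ → g ≈[ L ] g′ →
  (proj₁ (iterate step₀ k (f , g)) ≈[ L ] proj₁ (iterate step₀ k (f′ , g′))) ×
  (proj₂ (iterate step₀ k (f , g)) ≈[ L ] proj₂ (iterate step₀ k (f′ , g′)))
iterate-step₀-≈ L zero    f≈f′ g≈g′ = f≈f′ , g≈g′
iterate-step₀-≈ L (suc k) f≈f′ g≈g′ with iterate-step₀-≈ L k f≈f′ g≈g′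
... | f≈ , g≈ = (λ j j<L → cong₂ _+_ (f≈ j j<L) (x*g≈ j j<L)) ,
  (λ j j<L → cong₂ _+_ (x*g≈ j j<L) (x*g≈ j j<L))
  where x*g≈ = ≈-weaken (ℕ.n≤1+n L) (x*-≈ g≈)

-- The companion series `g` and `g′` are arbitrary because the `L` ones shift them beyond the
-- precision.
blockState-≈ : ∀ {f f′} L → f ≈[ L ] f′ → ∀ g g′ →
  proj₁ (blockState L (f , g)) ≈[ L ] proj₁ (blockState L (f′ , g′))
blockState-≈ L f≈f′ g g′ with iterate-step₁-≈ L L f≈f′ ℕ.≤-refl g g′
... | f≈ , g≈ = proj₁ (iterate-step₀-≈ L L f≈ g≈)

-- Multiplication by 1 + x/2.
β : PowerSeries → PowerSeries
β f j = f j + ½ * (x* f) j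

β-≈ : ∀ {f g L} → f ≈[ L ] g → β f ≈[ L ] β g
β-≈ {L = L} f≈g j j<L = cong₂ (λ a b → a + ½ * b) (f≈g j j<L)
  (≈-weaken (ℕ.n≤1+n L) (x*-≈ f≈g) j j<L)

βˢ : State → State
βˢ (f , g) = β f , β g

-- The steps consist of sums, constant factors and multiplication by x, so they are linear over
-- power series. The coefficient at 0 is separate because `x*_` is defined by cases.
step₀-β : ∀ s → step₀ (βˢ s) ≋ βˢ (step₀ s)
step₀-β (f , g) = first , second
  where
  first : ∀ j → proj₁ (step₀ (βˢ (f , g))) j ≡ β (proj₁ (step₀ (f , g))) j
  first zero    = solve 1 (λ f → f :+ con ½ :* con 0ℚ :+ con 0ℚ :=
      f :+ con 0ℚ :+ con ½ :* con 0ℚ) refl (f 0)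
  first (suc j) = solve 4 (λ a b c d → a :+ con ½ :* b :+ (c :+ con ½ :* d) :=
      a :+ c :+ con ½ :* (b :+ d)) refl (f (suc j)) (f j) (g j) ((x* g) j)
  second : ∀ j → proj₂ (step₀ (βˢ (f , g))) j ≡ β (proj₂ (step₀ (f , g))) j
  second zero    = refl
  second (suc j) = solve 2 (λ c d → c :+ con ½ :* d :+ (c :+ con ½ :* d) :=
      c :+ c :+ con ½ :* (d :+ d)) refl (g j) ((x* g) j)

step₁-β : ∀ s → step₁ (βˢ s) ≋ βˢ (step₁ s)
step₁-β (f , g) = (λ _ → refl) , second
  where
  second : ∀ j → proj₂ (step₁ (βˢ (f , g))) j ≡ β (proj₂ (step₁ (f , g))) j
  second zero    = solve 1 (λ f → con ½ :* (f :+ con ½ :* con 0ℚ :+ con 0ℚ) :=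
      con ½ :* (f :+ con 0ℚ) :+ con ½ :* con 0ℚ) refl (f 0)
  second (suc j) = solve 4 (λ a b c d → con ½ :* (a :+ con ½ :* b :+ (c :+ con ½ :* d)) :=
      con ½ :* (a :+ c) :+ con ½ :* (con ½ :* (b :+ d))) refl (f (suc j)) (f j) (g j) ((x* g) j)

iterate-β : ∀ {h} → (∀ {s t} → s ≋ t → h s ≋ h t) → (∀ s → h (βˢ s) ≋ βˢ (h s)) →
            ∀ k s → iterate h k (βˢ s) ≋ βˢ (iterate h k s)
iterate-β h-cong h-β zero    s = (λ _ → refl) , (λ _ → refl)
iterate-β {h} h-cong h-β (suc k) s = ≋-trans (h-cong (iterate-β h-cong h-β k s))
  (h-β (iterate h k s))

blockState-β : ∀ L s → blockState L (βˢ s) ≋ βˢ (blockState L s)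
blockState-β L s = ≋-trans (iterate-cong step₀-cong L (iterate-β step₁-cong step₁-β L s))
  (iterate-β step₀-cong step₀-β L (iterate step₁ L s))

0ₛ : PowerSeries
0ₛ _ = 0ℚ

-- The choice of `0ₛ` as companion is immaterial modulo xᴸ by `blockState-≈`.
α : ℕ → PowerSeries → PowerSeries
α L f = proj₁ (blockState L (f , 0ₛ))

ϑ-series-block : ∀ L n → ϑ-series (block L n) ≈[ L ] α L (ϑ-series n)
ϑ-series-block L n j j<L = trans (proj₁ (state-block L n) j)
  (blockState-≈ L (λ _ _ → refl) (ψ-series n) 0ₛ j j<L)

α-≈ : ∀ {f g} L → f ≈[ L ] g → α L f ≈[ L ] α L g
α-≈ L f≈g = blockState-≈ L f≈g 0ₛ 0ₛ

α-β : ∀ L f → α L (β f) ≈[ L ] β (α L f)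
-- The companion `0ₛ` is exchanged for `β 0ₛ`, so that the whole state is an image under `βˢ`.
α-β L f j j<L = trans (blockState-≈ L (λ _ _ → refl) 0ₛ (β 0ₛ) j j<L)
  (proj₁ (blockState-β L (f , 0ₛ)) j)

-- Every digit 0 multiplies the companion series by 2x.
ψ-series-append-0 : ∀ k n → ψ-series (append 0F k n) ≈[ k ] 0ₛ
ψ-series-append-0 (suc k) n j j≤k = trans (ψ-series-▹0 (append 0F k n) j)
  (cong (λ z → z + z) (x*≈0 j j≤k))
  where
  x*≈0 : (x* ψ-series (append 0F k n)) ≈[ suc k ] 0ₛ
  x*≈0 zero    _         = refl
  x*≈0 (suc j) (s≤s j<k) = ψ-series-append-0 k n j j<k

-- After the zeros the companion vanishes modulo xᴸ. The digit 1 keeps T and sets the companion to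
-- T/2; the digit 0 adds x times that to T.
ϑ-series-block10 : ∀ L n → ϑ-series (block L n ▹ 1F ▹ 0F) ≈[ L ] β (ϑ-series (block L n))
ϑ-series-block10 L n j j<L = begin
  ϑ-series (b ▹ 1F ▹ 0F) j
    ≡⟨ ϑ-series-▹0 (b ▹ 1F) j ⟩
  ϑ-series (b ▹ 1F) j + (x* ψ-series (b ▹ 1F)) j
    ≡⟨ cong₂ _+_ (ϑ-series-▹1 b j) (shifted j j<L) ⟩
  β (ϑ-series b) j ∎
  where
  open ≡-Reasoning
  b = block L n
  shifted : ∀ j → j ℕ.< L → (x* ψ-series (b ▹ 1F)) j ≡ ½ * (x* ϑ-series b) j
  shifted zero    _      = refl
  shifted (suc j) 1+j<L = trans (ψ-series-▹1 b j)
    (cong (½ *_) (trans (cong (_+_ (ϑ-series b j)) (vanish j (ℕ.<⇒≤ 1+j<L)))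
      (ℚ.+-identityʳ (ϑ-series b j))))
    where
    vanish : ∀ j → j ℕ.< L → (x* ψ-series b) j ≡ 0ℚ
    vanish zero    _     = refl
    vanish (suc j) 1+j<L = ψ-series-append-0 L (append 1F L n) j (ℕ.<⇒≤ 1+j<L)

ϑ-series-blocks10 : ∀ L t → ϑ-series (blocks10 L t) ≈[ L ] iterate β t (ϑ-series (blocks L t))
ϑ-series-blocks10 L zero    j j<L = refl
ϑ-series-blocks10 L (suc t) j j<L = begin
  ϑ-series (block L (blocks10 L t) ▹ 1F ▹ 0F) j
    ≡⟨ ϑ-series-block10 L (blocks10 L t) j j<L ⟩
  β (ϑ-series (block L (blocks10 L t))) j
    ≡⟨ β-≈ (ϑ-series-block L (blocks10 L t)) j j<L ⟩
  β (α L (ϑ-series (blocks10 L t))) j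
    ≡⟨ β-≈ (α-≈ L (ϑ-series-blocks10 L t)) j j<L ⟩
  β (α L (iterate β t (ϑ-series (blocks L t)))) j
    ≡⟨ β-≈ (commute t (ϑ-series (blocks L t))) j j<L ⟩
  β (iterate β t (α L (ϑ-series (blocks L t)))) j
    ≡⟨ β-≈ (iterate-≈ t (ϑ-series-block L (blocks L t))) j j<L ⟨
  β (iterate β t (ϑ-series (block L (blocks L t)))) j ∎
  where
  open ≡-Reasoning
  commute : ∀ t f → α L (iterate β t f) ≈[ L ] iterate β t (α L f)
  commute zero    f j j<L = refl
  commute (suc t) f j j<L = trans (α-β L (iterate β t f) j j<L) (β-≈ (commute t f) j j<L)
  iterate-≈ : ∀ {f g} t → f ≈[ L ] g → iterate β t f ≈[ L ] iterate β t g
  iterate-≈ zero    f≈g = f≈g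
  iterate-≈ (suc t) f≈g = β-≈ (iterate-≈ t f≈g)

-- Powers of 1 + x/2

-- The Cauchy product, with the first factor peeled, so that statements about all coefficients of
-- that factor pass through by induction on the degree.
conv : PowerSeries → PowerSeries → PowerSeries
conv b f zero    = b 0 * f 0
conv b f (suc j) = b 0 * f (suc j) + conv (λ i → b (suc i)) f j

conv-congˡ : ∀ {b c} f j → (∀ i → b i ≡ c i) → conv b f j ≡ conv c f j
conv-congˡ f zero    b≡c = cong (_* f 0) (b≡c 0)
conv-congˡ f (suc j) b≡c = cong₂ (λ x y → x * f (suc j) + y) (b≡c 0)
  (conv-congˡ f j (λ i → b≡c (suc i)))

conv-congʳ : ∀ b {f g} j → (∀ i → i ℕ.≤ j → f i ≡ g i) → conv b f j ≡ conv b g j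
conv-congʳ b zero    f≡g = cong (b 0 *_) (f≡g 0 z≤n)
conv-congʳ b (suc j) f≡g = cong₂ (λ x y → b 0 * x + y) (f≡g (suc j) ℕ.≤-refl)
  (conv-congʳ (λ i → b (suc i)) j (λ i i≤j → f≡g i (ℕ.m≤n⇒m≤1+n i≤j)))

conv-zeroˡ : ∀ f j → conv (λ _ → 0ℚ) f j ≡ 0ℚ
conv-zeroˡ f zero    = ℚ.*-zeroˡ (f 0)
conv-zeroˡ f (suc j) = cong₂ _+_ (ℚ.*-zeroˡ (f (suc j))) (conv-zeroˡ f j)

conv-oneˡ : ∀ f j → conv oneₛ f j ≡ f j
conv-oneˡ f zero    = ℚ.*-identityˡ (f 0)
conv-oneˡ f (suc j) = trans (cong₂ _+_ (ℚ.*-identityˡ (f (suc j))) (conv-zeroˡ f j))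
  (ℚ.+-identityʳ (f (suc j)))

conv-oneʳ : ∀ b j → conv b oneₛ j ≡ b j
conv-oneʳ b zero    = ℚ.*-identityʳ (b 0)
conv-oneʳ b (suc j) = trans (cong₂ _+_ (ℚ.*-zeroʳ (b 0)) (conv-oneʳ (λ i → b (suc i)) j))
  (ℚ.+-identityˡ (b (suc j)))

conv-linearˡ : ∀ b c d f j → conv (λ i → b i + d * c i) f j ≡ conv b f j + d * conv c f j
conv-linearˡ b c d f zero    =
  solve 4 (λ b c d f → (b :+ d :* c) :* f := b :* f :+ d :* (c :* f)) refl (b 0) (c 0) d (f 0)
conv-linearˡ b c d f (suc j) = trans
  (cong (_+_ ((b 0 + d * c 0) * f (suc j))) (conv-linearˡ (λ i → b (suc i))
      (λ i → c (suc i)) d f j))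
  (solve 6 (λ b c d f x y → (b :+ d :* c) :* f :+ (x :+ d :* y) :=
      b :* f :+ x :+ d :* (c :* f :+ y))
    refl (b 0) (c 0) d (f (suc j)) (conv (λ i → b (suc i)) f j) (conv (λ i → c (suc i)) f j))

-- Associativity of the product in a special case: the hypotheses say that `c` is (1 + x/2) times
-- `b`.
conv-pascal : ∀ {b c} f → c 0 ≡ b 0 → (∀ i → c (suc i) ≡ b (suc i) + ½ * b i) → ∀ j → conv c f j ≡
  β (conv b f) j
conv-pascal {b} {c} f c₀≡b₀ pascal zero    = trans (cong (_* f 0) c₀≡b₀)
  (solve 1 (λ x → x := x :+ con ½ :* con 0ℚ) refl (b 0 * f 0))
conv-pascal {b} {c} f c₀≡b₀ pascal (suc j) = begin
  c 0 * f (suc j) + conv (λ i → c (suc i)) f j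
    ≡⟨ cong₂ (λ x y → x * f (suc j) + y) c₀≡b₀ (conv-congˡ f j pascal) ⟩
  b 0 * f (suc j) + conv (λ i → b (suc i) + ½ * b i) f j
    ≡⟨ cong (_+_ (b 0 * f (suc j))) (conv-linearˡ (λ i → b (suc i)) b ½ f j) ⟩
  b 0 * f (suc j) + (conv (λ i → b (suc i)) f j + ½ * conv b f j)
    ≡⟨ ℚ.+-assoc (b 0 * f (suc j)) _ _ ⟨
  β (conv b f) (suc j) ∎
  where open ≡-Reasoning

-- The Leibniz rule. The second factor is only required to have jets up to degree `j`, since only
-- finitely many `P i` can be controlled by one length bound.
jet-conv : ∀ {B G : ℕ → ℕ → ℚ} {b₀ b₁ g₀ g₁ : PowerSeries} j →
  (∀ i → Jet (B i) (b₀ i) (b₁ i)) → (∀ i → i ℕ.≤ j → Jet (G i) (g₀ i) (g₁ i)) →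
  Jet (λ t → conv (λ i → B i t) (λ i → G i t) j) (conv b₀ g₀ j) (conv b₀ g₁ j + conv b₁ g₀ j)
jet-conv zero    jetB jetG = jet-* (jetB 0) (jetG 0 z≤n)
jet-conv {b₀ = b₀} {b₁} {g₀} {g₁} (suc j) jetB jetG = subst (Jet _ _)
  (solve 4 (λ x y z w → x :+ y :+ (z :+ w) := x :+ z :+ (y :+ w)) refl
    (b₀ 0 * g₁ (suc j)) (b₁ 0 * g₀ (suc j)) (conv (λ i → b₀ (suc i)) g₁ j)
      (conv (λ i → b₁ (suc i)) g₀ j))
  (jet-+ (jet-* (jetB 0) (jetG (suc j) ℕ.≤-refl))
    (jet-conv {b₀ = λ i → b₀ (suc i)} {λ i → b₁ (suc i)} {g₀} {g₁} j (λ i → jetB (suc i))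
      (λ i i≤j → jetG i (ℕ.m≤n⇒m≤1+n i≤j))))

1/suc : ℕ → ℚ
1/suc i = recip (fromℕ (suc i))

suc*1/suc : ∀ i → fromℕ (suc i) * 1/suc i ≡ 1ℚ
suc*1/suc i = *-recip (fromℕ (suc i)) (0<fromℕ-suc i)

-- The coefficient of xⁱ in (1 + x/2)ᵗ, namely binomial(t, i) / 2ⁱ.
binomial : ℕ → ℕ → ℚ
binomial zero    t = 1ℚ
binomial (suc i) t = ½ * 1/suc i * (binomial i t * (fromℕ t - fromℕ i))

binomial-suc : ∀ i t → binomial i (suc t) * (fromℕ (suc t) - fromℕ i) ≡ fromℕ (suc t) * binomial i t
binomial-suc zero    t = solve 1 (λ x → con 1ℚ :* (x :- con 0ℚ) := x :* con 1ℚ) refl (fromℕ (suc t))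
binomial-suc (suc i) t = begin
  ½ * r * (binomial i (suc t) * (fromℕ (suc t) - fromℕ i)) * (fromℕ (suc t) - fromℕ (suc i))
    ≡⟨ cong (λ z → ½ * r * z * (fromℕ (suc t) - fromℕ (suc i))) (binomial-suc i t) ⟩
  ½ * r * (fromℕ (suc t) * binomial i t) * (fromℕ (suc t) - fromℕ (suc i))
    ≡⟨ solve 4 (λ r b x y → con ½ :* r :* ((con 1ℚ :+ x) :* b) :*
      ((con 1ℚ :+ x) :- (con 1ℚ :+ y)) :=
                 (con 1ℚ :+ x) :* (con ½ :* r :* (b :* (x :- y)))) refl r (binomial i t) (fromℕ t)
                   (fromℕ i) ⟩
  fromℕ (suc t) * (½ * r * (binomial i t * (fromℕ t - fromℕ i))) ∎
  where
  open ≡-Reasoning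
  r = 1/suc i

binomial-pascal : ∀ i t → binomial (suc i) (suc t) ≡ binomial (suc i) t + ½ * binomial i t
binomial-pascal i t = begin
  ½ * r * (binomial i (suc t) * (fromℕ (suc t) - fromℕ i))
    ≡⟨ cong (½ * r *_) (binomial-suc i t) ⟩
  ½ * r * ((1ℚ + fromℕ t) * b)
    ≡⟨ solve 4 (λ r b x y → con ½ :* r :* ((con 1ℚ :+ x) :* b) :=
         con ½ :* r :* (b :* (x :- y)) :+ con ½ :* ((con 1ℚ :+ y) :* r) :* b) refl r b (fromℕ t)
           (fromℕ i) ⟩
  binomial (suc i) t + ½ * (fromℕ (suc i) * r) * b
    ≡⟨ cong (λ z → binomial (suc i) t + ½ * z * b) (suc*1/suc i) ⟩
  binomial (suc i) t + ½ * b ∎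
  where
  open ≡-Reasoning
  r = 1/suc i
  b = binomial i t

binomial-0 : ∀ i → binomial i 0 ≡ oneₛ i
binomial-0 zero          = refl
binomial-0 (suc zero)    = refl
binomial-0 (suc (suc i)) = trans (cong (λ z → ½ * 1/suc (suc i) * (z * (0ℚ - fromℕ (suc i))))
  (binomial-0 (suc i)))
  (solve 2 (λ r x → con ½ :* r :* (con 0ℚ :* (con 0ℚ :- x)) := con 0ℚ) refl (1/suc (suc i))
      (fromℕ (suc i)))

iterate-β-conv : ∀ t f j → iterate β t f j ≡ conv (λ i → binomial i t) f j
iterate-β-conv zero    f j = sym (trans (conv-congˡ f j binomial-0) (conv-oneˡ f j))
iterate-β-conv (suc t) f j = trans (β-≈ {L = suc j} (λ i _ → iterate-β-conv t f i) j ℕ.≤-refl)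
  (sym (conv-pascal f refl (λ i → binomial-pascal i t) j))

-- The series log(1 + x/2)

sign : ℕ → ℚ
sign zero    = 1ℚ
sign (suc i) = - sign i

-- The Taylor coefficients of log(1 + x/2) in closed form; `log1+x/2` links them to the definition
-- by powers.
log-coefficient : PowerSeries
log-coefficient zero    = 0ℚ
log-coefficient (suc i) = sign i * half^ (suc i) * 1/suc i

-- Coefficientwise form of (1 + x/2)ᵗ = 1 + t log(1 + x/2) + ..., proved through the factorisation
-- of binomials into linear factors in t.
jet-binomial : ∀ i → Jet (binomial i) (oneₛ i) (log-coefficient i)
jet-binomial zero          = jet-constant 1ℚ
jet-binomial (suc i) = subst₂ (Jet (binomial (suc i)))
  (trans (sym (jet-value product)) (binomial-0 (suc i))) (linear-part i) product
  where
  product = jet-* (jet-constant (½ * 1/suc i))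
      (jet-* (jet-binomial i) (jet-+ jet-identity (jet-constant (- fromℕ i))))
  linear-part : ∀ i → ½ * 1/suc i * (oneₛ i * (1ℚ + 0ℚ) + log-coefficient i * (0ℚ - fromℕ i)) + 0ℚ *
      (oneₛ i * (0ℚ - fromℕ i))
                ≡ log-coefficient (suc i)
  linear-part zero    = refl
  -- The constant term of the lower binomial is 0, so only its derivative counts; the factor
  -- `0ℚ - n` cancels the denominator k + 1 and flips the sign.
  linear-part (suc k) = begin
    ½ * q * (0ℚ * (1ℚ + 0ℚ) + s * (½ * h) * r * (0ℚ - n)) + 0ℚ * (0ℚ * (0ℚ - n))
      ≡⟨ solve 5 (λ q s h r n → con ½ :* q :*
        (con 0ℚ :* (con 1ℚ :+ con 0ℚ) :+ s :* (con ½ :* h) :* r :* (con 0ℚ :- n)) :+ con 0ℚ :*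
          (con 0ℚ :* (con 0ℚ :- n)) :=
                   (:- s) :* (con ½ :* (con ½ :* h)) :* q :* (n :* r)) refl q s h r n ⟩
    - s * (½ * (½ * h)) * q * (n * r)
      ≡⟨ cong (- s * (½ * (½ * h)) * q *_) (suc*1/suc k) ⟩
    - s * (½ * (½ * h)) * q * 1ℚ
      ≡⟨ ℚ.*-identityʳ _ ⟩
    - s * (½ * (½ * h)) * q ∎
    where
    open ≡-Reasoning
    q = 1/suc (suc k)
    r = 1/suc k
    s = sign k
    h = half^ k
    n = fromℕ (suc k)

sum-zero : ∀ {n} (v : Vector ℚ n) → (∀ i → v i ≡ 0ℚ) → sum v ≡ 0ℚ
sum-zero {zero}  v v≡0 = refl
sum-zero {suc n} v v≡0 = cong₂ _+_ (v≡0 Fin.zero)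
  (sum-zero (λ i → v (Fin.suc i)) (λ i → v≡0 (Fin.suc i)))

x/2*ₛ : ∀ g n → (x/2 *ₛ g) n ≡ ½ * (x* g) n
x/2*ₛ g zero    = trans (ℚ.+-identityʳ (0ℚ * g 0)) (ℚ.*-zeroˡ (g 0))
x/2*ₛ g (suc n) = begin
  0ℚ * g (suc n) + (½ * g n + sum higher)
    ≡⟨ cong (λ z → 0ℚ * g (suc n) + (½ * g n + z)) higher≡0 ⟩
  0ℚ * g (suc n) + (½ * g n + 0ℚ)
    ≡⟨ solve 2 (λ x y → con 0ℚ :* x :+ (con ½ :* y :+ con 0ℚ) := con ½ :* y) refl (g (suc n))
      (g n) ⟩
  ½ * g n ∎
  where
  open ≡-Reasoning
  higher : Vector ℚ n
  higher i = 0ℚ * g (suc n ℕ.∸ suc (suc (toℕ i)))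
  higher≡0 : sum higher ≡ 0ℚ
  higher≡0 = sum-zero higher (λ i → ℚ.*-zeroˡ (g (suc n ℕ.∸ suc (suc (toℕ i)))))

x/2^-diagonal : ∀ k → (x/2 ^ₛ k) k ≡ half^ k
x/2^-diagonal zero    = refl
x/2^-diagonal (suc k) = trans (x/2*ₛ (x/2 ^ₛ k) (suc k)) (cong (½ *_) (x/2^-diagonal k))

x/2^-beyond : ∀ {k n} → k ℕ.< n → (x/2 ^ₛ k) n ≡ 0ℚ
x/2^-beyond {zero}  {suc n} _         = refl
x/2^-beyond {suc k} {suc n} (s≤s k<n) = trans (x/2*ₛ (x/2 ^ₛ k) (suc n))
  (cong (½ *_) (x/2^-beyond k<n))

1/suc≡ : ∀ k → + 1 / suc k ≡ 1/suc k
1/suc≡ k = pos*-cancelˡ (fromℕ (suc k)) (0<fromℕ-suc k)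
  (trans (/-denominator 1 (suc k)) (sym (suc*1/suc k)))

-1^/suc : ∀ k d → (-1ℤ ℤ.^ k) / suc d ≡ sign k * 1/suc d
-1^/suc k d = trans (parity k) (cong (sign k *_) (1/suc≡ d))
  where
  neg-/ : ∀ i → (-1ℤ ℤ.* i) / suc d ≡ - (i / suc d)
  neg-/ i = trans (ℚ./-cong { -1ℤ ℤ.* i} {suc d} (ℤ.-1*i≡-i i) refl) (neg i)
    where
    -- Cases on the integer, because `_/_` computes by the sign of its numerator.
    neg : ∀ i → (ℤ.- i) / suc d ≡ - (i / suc d)
    neg (+ 0)       = trans (ℚ.0/n≡0 (suc d)) (cong -_ (sym (ℚ.0/n≡0 (suc d))))
    neg ℤ.+[1+ n ]  = refl
    neg -[1+ n ]    = solve 1 (λ x → x := :- (:- x)) refl (+ suc n / suc d)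
  parity : ∀ k → (-1ℤ ℤ.^ k) / suc d ≡ sign k * (+ 1 / suc d)
  parity zero    = sym (ℚ.*-identityˡ (+ 1 / suc d))
  parity (suc k) = trans (neg-/ (-1ℤ ℤ.^ k)) (trans (cong -_ (parity k))
      (ℚ.neg-distribˡ-* (sign k) (+ 1 / suc d)))

-- The powers of x/2 are monomials, so only the last summand reaches degree n.
log1+x/2 : ∀ n → log1+ x/2 refl n ≡ log-coefficient n
log1+x/2 zero    = refl
log1+x/2 (suc n) = begin
  sum term
    ≡⟨ sum-init-last term ⟩
  sum (λ i → term (inject₁ i)) + term (Fin.fromℕ n)
    ≡⟨ cong₂ _+_ (sum-zero (λ i → term (inject₁ i)) initial) final ⟩
  0ℚ + log-coefficient (suc n)
    ≡⟨ ℚ.+-identityˡ _ ⟩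
  log-coefficient (suc n) ∎
  where
  open ≡-Reasoning
  term-at : ℕ → ℚ
  term-at k = (-1ℤ ℤ.^ k) / suc k * (x/2 ^ₛ suc k) (suc n)
  term : Vector ℚ (suc n)
  term k = term-at (toℕ k)
  initial : ∀ i → term (inject₁ i) ≡ 0ℚ
  initial i = trans (cong term-at (Fin.toℕ-inject₁ i))
    (trans (cong ((-1ℤ ℤ.^ toℕ i) / suc (toℕ i) *_) (x/2^-beyond (s≤s (Fin.toℕ<n i))))
      (ℚ.*-zeroʳ ((-1ℤ ℤ.^ toℕ i) / suc (toℕ i))))
  final : term (Fin.fromℕ n) ≡ log-coefficient (suc n)
  final = trans (cong term-at (Fin.toℕ-fromℕ n))
    (trans (cong₂ _*_ (-1^/suc n n) (x/2^-diagonal (suc n)))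
      (solve 3 (λ s r h → s :* r :* h := s :* h :* r) refl (sign n) (1/suc n) (half^ (suc n))))

-- Riemann sums of 1/t

*-monoʳ-≤ : ∀ {p q r} → 0ℚ ≤ r → p ≤ q → r * p ≤ r * q
*-monoʳ-≤ {r = r} 0≤r = ℚ.*-monoˡ-≤-nonNeg r {{nonNegative 0≤r}}

*-monoˡ-≤ : ∀ {p q r} → 0ℚ ≤ r → p ≤ q → p * r ≤ q * r
*-monoˡ-≤ {r = r} 0≤r = ℚ.*-monoʳ-≤-nonNeg r {{nonNegative 0≤r}}

p≤q⇒0≤q-p : ∀ {p q} → p ≤ q → 0ℚ ≤ q - p
p≤q⇒0≤q-p {p} {q} p≤q = subst (_≤ q - p) (ℚ.+-inverseʳ p) (ℚ.+-monoˡ-≤ (- p) p≤q)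

pow : ℚ → ℕ → ℚ
pow u zero    = 1ℚ
pow u (suc m) = u * pow u m

0≤pow : ∀ {u} m → 0ℚ ≤ u → 0ℚ ≤ pow u m
0≤pow zero    0≤u = ℚ.nonNegative⁻¹ 1ℚ
0≤pow (suc m) 0≤u = 0≤* 0≤u (0≤pow m 0≤u)

pow-mono : ∀ {u v} m → 0ℚ ≤ u → u ≤ v → pow u m ≤ pow v m
pow-mono zero    0≤u u≤v = ℚ.≤-refl
pow-mono {u} {v} (suc m) 0≤u u≤v = ℚ.≤-trans (*-monoʳ-≤ 0≤u (pow-mono m 0≤u u≤v))
  (*-monoˡ-≤ (0≤pow m (ℚ.≤-trans 0≤u u≤v)) u≤v)

half^≡pow : ∀ m → half^ m ≡ pow ½ m
half^≡pow zero    = refl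
half^≡pow (suc m) = cong (½ *_) (half^≡pow m)

pow-difference : ∀ u v m → pow v (suc (suc m)) - pow u (suc (suc m)) ≡
                           v * (pow v (suc m) - pow u (suc m)) + (v - u) * pow u (suc m)
pow-difference u v m = solve 4 (λ u v x y → v :* x :- u :* y := v :* (x :- y) :+ (v :- u) :* y)
  refl u v (pow v (suc m)) (pow u (suc m))

module _ {u v : ℚ} (0≤u : 0ℚ ≤ u) (u≤v : u ≤ v) where

  open ℚ.≤-Reasoning

  private
    0≤v : 0ℚ ≤ v
    0≤v = ℚ.≤-trans 0≤u u≤v
    0≤v-u : 0ℚ ≤ v - u
    0≤v-u = p≤q⇒0≤q-p u≤v

  -- The difference of the powers is v - u times a sum of m + 1 products of degree m in u and v,
  -- each at least uᵐ. The induction over `pow-difference` builds this sum.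
  pow-difference-lower : ∀ m → fromℕ (suc m) * ((v - u) * pow u m) ≤ pow v (suc m) - pow u (suc m)
  pow-difference-lower zero = ℚ.≤-reflexive
    (solve 2 (λ u v → (con 1ℚ :+ con 0ℚ) :* ((v :- u) :* con 1ℚ) :=
      v :* con 1ℚ :- u :* con 1ℚ) refl u v)
  pow-difference-lower (suc m) = begin
    (1ℚ + n) * (d * (u * p))
      ≡⟨ solve 4 (λ n d u p → (con 1ℚ :+ n) :* (d :* (u :* p)) :=
        u :* (n :* (d :* p)) :+ d :* (u :* p)) refl n d u p ⟩
    u * (n * (d * p)) + d * (u * p)
      ≤⟨ ℚ.+-monoˡ-≤ (d * (u * p)) (*-monoˡ-≤
        (0≤* (0≤fromℕ (suc m)) (0≤* 0≤v-u (0≤pow m 0≤u))) u≤v) ⟩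
    v * (n * (d * p)) + d * (u * p)
      ≤⟨ ℚ.+-monoˡ-≤ (d * (u * p)) (*-monoʳ-≤ 0≤v (pow-difference-lower m)) ⟩
    v * (pow v (suc m) - pow u (suc m)) + d * (u * p)
      ≡⟨ pow-difference u v m ⟨
    pow v (suc (suc m)) - pow u (suc (suc m)) ∎
    where
    n = fromℕ (suc m)
    d = v - u
    p = pow u m

  pow-difference-upper : ∀ m → pow v (suc m) - pow u (suc m) ≤ fromℕ (suc m) * ((v - u) * pow v m)
  pow-difference-upper zero = ℚ.≤-reflexive
    (solve 2 (λ u v → v :* con 1ℚ :- u :* con 1ℚ :=
      (con 1ℚ :+ con 0ℚ) :* ((v :- u) :* con 1ℚ)) refl u v)
  pow-difference-upper (suc m) = begin
    pow v (suc (suc m)) - pow u (suc (suc m))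
      ≡⟨ pow-difference u v m ⟩
    v * (pow v (suc m) - pow u (suc m)) + d * pow u (suc m)
      ≤⟨ ℚ.+-mono-≤ (*-monoʳ-≤ 0≤v (pow-difference-upper m))
        (*-monoʳ-≤ 0≤v-u (pow-mono (suc m) 0≤u u≤v)) ⟩
    v * (n * (d * q)) + d * (v * q)
      ≡⟨ solve 4 (λ n d v q → v :* (n :* (d :* q)) :+ d :* (v :* q) :=
        (con 1ℚ :+ n) :* (d :* (v :* q))) refl n d v q ⟩
    (1ℚ + n) * (d * (v * q)) ∎
    where
    n = fromℕ (suc m)
    d = v - u
    q = pow v m

midpoint-bounds : ∀ {a b} → a ≤ b → a ≤ midpoint a b × midpoint a b ≤ b
midpoint-bounds {a} {b} a≤b =
  ≤-from-difference (½ * (b - a)) (solve 2 (λ a b → a :+ con ½ :* (b :- a) :=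
      con ½ :* (a :+ b)) refl a b) 0≤ ,
  ≤-from-difference (½ * (b - a)) (solve 2 (λ a b → con ½ :* (a :+ b) :+ con ½ :* (b :- a) :=
      b) refl a b) 0≤
  where
  0≤ : 0ℚ ≤ ½ * (b - a)
  0≤ = 0≤* (ℚ.nonNegative⁻¹ ½) (p≤q⇒0≤q-p a≤b)

module _ (m : ℕ) where

  power antiderivative : ℚ → ℚ
  power t     = pow (t - 1ℚ) m
  antiderivative t = pow (t - 1ℚ) (suc m) * 1/suc m

  private
    0≤1/suc : 0ℚ ≤ 1/suc m
    0≤1/suc = ℚ.<⇒≤ (0<⇒0<recip (fromℕ (suc m)) (0<fromℕ-suc m))

    cancel : ∀ x → fromℕ (suc m) * x * 1/suc m ≡ x
    cancel x = trans (solve 3 (λ n x r → n :* x :* r := x :* (n :* r)) refl (fromℕ (suc m)) x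
      (1/suc m))
      (trans (cong (x *_) (suc*1/suc m)) (ℚ.*-identityʳ x))

    shift : ∀ a b → (b - 1ℚ) - (a - 1ℚ) ≡ b - a
    shift = solve 2 (λ a b → (b :- con 1ℚ) :- (a :- con 1ℚ) := b :- a) refl

    telescope : ∀ x y z → (y - x) + (z - y) ≡ z - x
    telescope = solve 3 (λ x y z → (y :- x) :+ (z :- y) := z :- x) refl

    distrib : ∀ x y r → (x - y) * r ≡ x * r - y * r
    distrib = solve 3 (λ x y r → (x :- y) :* r := x :* r :- y :* r) refl

  -- The function (t - 1)ᵐ increases for t ≥ 1, so sums at left endpoints stay below the integral.
  -- One interval is `pow-difference-lower` divided by m + 1; the halves telescope.
  riemann′-power≤ : ∀ k {a b} → 1ℚ ≤ a → a ≤ b →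
      riemann′ power k a b ≤ antiderivative b - antiderivative a
  riemann′-power≤ zero {a} {b} 1≤a a≤b = subst₂ _≤_
    (trans (cancel _) (cong (_* power a) (shift a b)))
    (distrib (pow (b - 1ℚ) (suc m)) (pow (a - 1ℚ) (suc m)) (1/suc m))
    (*-monoˡ-≤ 0≤1/suc (pow-difference-lower (p≤q⇒0≤q-p 1≤a) (ℚ.+-monoˡ-≤ (- 1ℚ) a≤b) m))
  riemann′-power≤ (suc k) {a} {b} 1≤a a≤b = let a≤m , m≤b = midpoint-bounds a≤b in
      ℚ.≤-trans (ℚ.+-mono-≤ (riemann′-power≤ k 1≤a a≤m) (riemann′-power≤ k (ℚ.≤-trans 1≤a a≤m) m≤b))
    (ℚ.≤-reflexive (telescope (antiderivative a) (antiderivative (midpoint a b))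
      (antiderivative b)))

  ≤riemann-power : ∀ k {a b} → 1ℚ ≤ a → a ≤ b →
      antiderivative b - antiderivative a ≤ riemann power k a b
  ≤riemann-power zero {a} {b} 1≤a a≤b = subst₂ _≤_
    (distrib (pow (b - 1ℚ) (suc m)) (pow (a - 1ℚ) (suc m)) (1/suc m))
    (trans (cancel _) (cong (_* power b) (shift a b)))
    (*-monoˡ-≤ 0≤1/suc (pow-difference-upper (p≤q⇒0≤q-p 1≤a) (ℚ.+-monoˡ-≤ (- 1ℚ) a≤b) m))
  ≤riemann-power (suc k) {a} {b} 1≤a a≤b = let a≤m , m≤b = midpoint-bounds a≤b in ℚ.≤-trans
    (ℚ.≤-reflexive (sym (telescope (antiderivative a) (antiderivative (midpoint a b))
      (antiderivative b))))
    (ℚ.+-mono-≤ (≤riemann-power k 1≤a a≤m) (≤riemann-power k (ℚ.≤-trans 1≤a a≤m) m≤b))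

-- Error bounds and the geometric series

infix 4 _within_
-- The absolute value bound as two inequalities, which add and scale without case distinctions.
record _within_ (x e : ℚ) : Set where
  constructor _,_
  field
    upper-bound : x ≤ e
    lower-bound : - x ≤ e

within-+ : ∀ {x y d e} → x within d → y within e → (x + y) within (d + e)
within-+ {x} {y} (p , q) (p′ , q′) = ℚ.+-mono-≤ p p′ ,
  ℚ.≤-trans (ℚ.≤-reflexive (ℚ.neg-distrib-+ x y)) (ℚ.+-mono-≤ q q′)

within-*ˡ : ∀ {x e c} → 0ℚ ≤ c → x within e → (c * x) within (c * e)
within-*ˡ {x} {e} {c} 0≤c (p , q) = *-monoʳ-≤ 0≤c p ,
  ℚ.≤-trans (ℚ.≤-reflexive (ℚ.neg-distribʳ-* c x)) (*-monoʳ-≤ 0≤c q)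

within-neg : ∀ {x e} → x within e → (- x) within e
within-neg {x} {e} (p , q) = q , subst (_≤ e) (solve 1 (λ x → x := :- (:- x)) refl x) p

within-sign : ∀ {x e} m → x within e → (sign m * x) within e
within-sign {x} {e} zero    x≤e = subst (_within e) (sym (ℚ.*-identityˡ x)) x≤e
within-sign {x} {e} (suc m) x≤e = subst (_within e) (ℚ.neg-distribˡ-* (sign m) x)
  (within-neg (within-sign m x≤e))

within-≤ : ∀ {x d e} → d ≤ e → x within d → x within e
within-≤ d≤e (p , q) = ℚ.≤-trans p d≤e , ℚ.≤-trans q d≤e

riemann-within : ∀ {f g e} k {a b} → a ≤ b → (∀ t → a ≤ t → t ≤ b → (f t - g t) within e) →
                 (riemann f k a b - riemann g k a b) within ((b - a) * e)
riemann-within {f} {g} {e} zero {a} {b} a≤b close = subst (_within ((b - a) * e))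
  (solve 3 (λ d x y → d :* (x :- y) := d :* x :- d :* y) refl (b - a) (f b) (g b))
  (within-*ˡ (p≤q⇒0≤q-p a≤b) (close b a≤b ℚ.≤-refl))
riemann-within {f} {g} {e} (suc k) {a} {b} a≤b close = let a≤m , m≤b = midpoint-bounds a≤b in
  subst₂ _within_
  (solve 4 (λ p q r s → (p :- q) :+ (r :- s) := (p :+ r) :- (q :+ s)) refl
    (riemann f k a c) (riemann g k a c) (riemann f k c b) (riemann g k c b))
  (solve 4 (λ a c b e → (c :- a) :* e :+ (b :- c) :* e := (b :- a) :* e) refl a c b e)
  (within-+ (riemann-within k a≤m (λ t a≤t t≤m → close t a≤t (ℚ.≤-trans t≤m m≤b)))
            (riemann-within k m≤b (λ t m≤t t≤b → close t (ℚ.≤-trans a≤m m≤t) t≤b)))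
  where c = midpoint a b

riemann-linear : ∀ f c g k a b → riemann (λ t → f t + c * g t) k a b ≡
  riemann f k a b + c * riemann g k a b
riemann-linear f c g zero a b =
  solve 4 (λ d x c y → d :* (x :+ c :* y) := d :* x :+ c :* (d :* y)) refl (b - a) (f b) c (g b)
riemann-linear f c g (suc k) a b = trans
  (cong₂ _+_ (riemann-linear f c g k a m) (riemann-linear f c g k m b))
  (solve 5 (λ x c y z w → x :+ c :* y :+ (z :+ c :* w) := x :+ z :+ c :* (y :+ w)) refl
    (riemann f k a m) c (riemann g k a m) (riemann f k m b) (riemann g k m b))
  where m = midpoint a b

riemann-zero : ∀ k a b → riemann (λ _ → 0ℚ) k a b ≡ 0ℚ
riemann-zero zero    a b = ℚ.*-zeroʳ (b - a)
riemann-zero (suc k) a b = cong₂ _+_ (riemann-zero k a (midpoint a b))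
  (riemann-zero k (midpoint a b) b)

-- The truncated expansion of 1/t in powers of t - 1.
geometric : ℕ → ℚ → ℚ
geometric zero    t = 0ℚ
geometric (suc m) t = geometric m t + sign m * power m t

geometric-sum : ∀ m t → t * geometric m t ≡ 1ℚ - sign m * power m t
geometric-sum zero    t = ℚ.*-zeroʳ t
geometric-sum (suc m) t = begin
  t * (geometric m t + s * p)
    ≡⟨ ℚ.*-distribˡ-+ t (geometric m t) (s * p) ⟩
  t * geometric m t + t * (s * p)
    ≡⟨ cong (_+ t * (s * p)) (geometric-sum m t) ⟩
  1ℚ - s * p + t * (s * p)
    ≡⟨ solve 3 (λ t s p → con 1ℚ :- s :* p :+ t :* (s :* p) :=
      con 1ℚ :- (:- s) :* ((t :- con 1ℚ) :* p)) refl t s p ⟩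
  1ℚ - - s * ((t - 1ℚ) * p) ∎
  where
  open ≡-Reasoning
  s = sign m
  p = power m t

3/2 : ℚ
3/2 = + 3 / 2

1≤3/2 : 1ℚ ≤ 3/2
1≤3/2 = ≤-from-difference ½ refl (ℚ.nonNegative⁻¹ ½)

-- The remainder is (t - 1)ᵐ / t up to sign, where t - 1 ≤ 1/2 and 1/t ≤ 1.
recip-geometric : ∀ m t → 1ℚ ≤ t → t ≤ 3/2 → (recip t - geometric m t) within half^ m
recip-geometric m t 1≤t t≤3/2 = subst (_within half^ m) (sym remainder) (within-sign m bound)
  where
  open ≡-Reasoning
  p = power m t
  0<t : 0ℚ < t
  0<t = ℚ.<-≤-trans (ℚ.positive⁻¹ 1ℚ) 1≤t
  0≤recip : 0ℚ ≤ recip t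
  0≤recip = ℚ.<⇒≤ (0<⇒0<recip t 0<t)
  remainder : recip t - geometric m t ≡ sign m * (p * recip t)
  remainder = begin
    recip t - geometric m t
      ≡⟨ cong (λ z → recip t - z) (trans (cong (_* geometric m t) (*-recip t 0<t))
        (ℚ.*-identityˡ (geometric m t))) ⟨
    recip t - t * recip t * geometric m t
      ≡⟨ solve 3 (λ t r g → r :- t :* r :* g := r :* (con 1ℚ :- t :* g)) refl t (recip t)
        (geometric m t) ⟩
    recip t * (1ℚ - t * geometric m t)
      ≡⟨ cong (λ z → recip t * (1ℚ - z)) (geometric-sum m t) ⟩
    recip t * (1ℚ - (1ℚ - sign m * p))
      ≡⟨ solve 3 (λ r s p → r :* (con 1ℚ :- (con 1ℚ :- s :* p)) := s :* (p :* r)) refl (recip t)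
        (sign m) p ⟩
    sign m * (p * recip t) ∎
  0≤t-1 : 0ℚ ≤ t - 1ℚ
  0≤t-1 = p≤q⇒0≤q-p 1≤t
  0≤p*recip : 0ℚ ≤ p * recip t
  0≤p*recip = 0≤* (0≤pow m 0≤t-1) 0≤recip
  recip≤1 : recip t ≤ 1ℚ
  recip≤1 = subst₂ _≤_ (ℚ.*-identityˡ (recip t)) (*-recip t 0<t) (*-monoˡ-≤ 0≤recip 1≤t)
  p≤half^ : p ≤ half^ m
  p≤half^ = ℚ.≤-trans (pow-mono m 0≤t-1 (ℚ.+-monoˡ-≤ (- 1ℚ) t≤3/2))
      (ℚ.≤-reflexive (sym (half^≡pow m)))
  bound : (p * recip t) within half^ m
  bound = ℚ.≤-trans (*-monoʳ-≤ (0≤pow m 0≤t-1) recip≤1)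
      (ℚ.≤-trans (ℚ.≤-reflexive (ℚ.*-identityʳ p)) p≤half^) ,
          ℚ.≤-trans (ℚ.neg-antimono-≤ 0≤p*recip) (0≤half^ m)

-- The subtracted value is the exact integral of (t - 1)ᵐ from 1 to 3/2. It lies between the left
-- and right sums, and `gap` bounds their distance.
riemann-power-within : ∀ m k → (riemann (power m) k 1ℚ 3/2 - half^ (suc m) * 1/suc m) within
  (half^ (suc m) * half^ k)
riemann-power-within m k = subst (λ z → (R - z) within (half^ (suc m) * half^ k))
  (sym antiderivative-value)
  (ℚ.≤-trans (ℚ.≤-trans (ℚ.+-monoʳ-≤ R (ℚ.neg-antimono-≤ (riemann′-power≤ m k ℚ.≤-refl 1≤3/2)))
      (ℚ.≤-reflexive R-R′)) gap≤ ,
   ℚ.≤-trans (ℚ.≤-trans (ℚ.≤-reflexive (solve 2 (λ r z → :- (r :- z) := z :- r) refl R I))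
     (ℚ.≤-trans (ℚ.+-monoˡ-≤ (- R) (≤riemann-power m k ℚ.≤-refl 1≤3/2))
       (ℚ.≤-reflexive (ℚ.+-inverseʳ R))))
     (0≤* (0≤half^ (suc m)) (0≤half^ k)))
  where
  R = riemann (power m) k 1ℚ 3/2
  R′ = riemann′ (power m) k 1ℚ 3/2
  I = antiderivative m 3/2 - antiderivative m 1ℚ
  antiderivative-value : half^ (suc m) * 1/suc m ≡ I
  antiderivative-value = trans (cong (_* 1/suc m) (half^≡pow (suc m)))
    (solve 3 (λ x z r → x :* r := x :* r :- con 0ℚ :* z :* r) refl (pow ½ (suc m)) (pow 0ℚ m)
      (1/suc m))
  R-R′ : R - R′ ≡ ½ * (power m 3/2 - power m 1ℚ) * half^ k
  R-R′ = trans (cong (λ z → R - z) (gap (power m) k 1ℚ 3/2))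
    (solve 4 (λ r x y h → r :- (r :+ con ½ :* (y :- x) :* h) := con ½ :* (x :- y) :* h) refl R
      (power m 3/2) (power m 1ℚ) (half^ k))
  gap≤ : ½ * (power m 3/2 - power m 1ℚ) * half^ k ≤ half^ (suc m) * half^ k
  gap≤ = *-monoˡ-≤ (0≤half^ k) (*-monoʳ-≤ (ℚ.nonNegative⁻¹ ½) (ℚ.≤-trans
    (ℚ.+-monoʳ-≤ (power m 3/2) (ℚ.neg-antimono-≤ (0≤pow m (ℚ.≤-refl {0ℚ}))))
    (ℚ.≤-reflexive (trans (ℚ.+-identityʳ (power m 3/2)) (sym (half^≡pow m))))))

partial : (ℕ → ℚ) → ℕ → ℚ
partial a zero    = 0ℚ
partial a (suc m) = partial a m + a m

sum≡partial : ∀ a m → (∑[ j < m ] a (toℕ j)) ≡ partial a m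
sum≡partial a zero    = refl
sum≡partial a (suc m) = trans (sum-init-last {m} (λ j → a (toℕ j)))
  (cong₂ _+_ (trans (sum-cong-≗ {m} (λ j → cong a (Fin.toℕ-inject₁ j))) (sum≡partial a m))
      (cong a (Fin.toℕ-fromℕ m)))

-- Integrating the i-th term gives coefficient i + 1 of the logarithm, so m terms match m + 1
-- coefficients, the coefficient at 0 being 0. The errors form a geometric sum, hence the factor
-- `1ℚ - half^ m`.
riemann-geometric-within : ∀ m k → (riemann (geometric m) k 1ℚ 3/2 - partial log-coefficient
  (suc m)) within
                                   ((1ℚ - half^ m) * half^ k)
riemann-geometric-within zero k = subst₂ _within_ (cong (_- 0ℚ) (sym (riemann-zero k 1ℚ 3/2)))
  (sym (ℚ.*-zeroˡ (half^ k)))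
  (ℚ.≤-refl , ℚ.≤-refl)
riemann-geometric-within (suc m) k = subst₂ _within_
  (trans (solve 6 (λ g s c r h i → (g :- c) :+ s :* (r :- h :* i) :=
      (g :+ s :* r) :- (c :+ s :* h :* i)) refl
           (riemann (geometric m) k 1ℚ 3/2) (sign m) (partial log-coefficient (suc m))
             (riemann (power m) k 1ℚ 3/2) (half^ (suc m)) (1/suc m))
    (cong (_- partial log-coefficient (suc (suc m)))
      (sym (riemann-linear (geometric m) (sign m) (power m) k 1ℚ 3/2))))
  (solve 2 (λ h k → (con 1ℚ :- h) :* k :+ con ½ :* h :* k := (con 1ℚ :- con ½ :* h) :* k) refl
      (half^ m) (half^ k))
  (within-+ (riemann-geometric-within m k) (within-sign m (riemann-power-within m k)))

half^-antitone : ∀ {m n} → m ℕ.≤ n → half^ n ≤ half^ m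
half^-antitone {n = n} z≤n = half^≤1 n
half^-antitone (s≤s m≤n)   = *-monoʳ-≤ (ℚ.nonNegative⁻¹ ½) (half^-antitone m≤n)

log-within : ∀ {N m k} → N ℕ.≤ m → N ℕ.≤ k →
  (riemann recip k 1ℚ 3/2 - partial log-coefficient (suc m)) within ((1ℚ + 1ℚ) * half^ N)
log-within {N} {m} {k} N≤m N≤k = subst₂ _within_
  (solve 3 (λ x y z → (x :- y) :+ (y :- z) := x :- z) refl
    (riemann recip k 1ℚ 3/2) (riemann (geometric m) k 1ℚ 3/2) (partial log-coefficient (suc m)))
  (solve 1 (λ h → h :+ h := (con 1ℚ :+ con 1ℚ) :* h) refl (half^ N))
  (within-+
    -- The interval has length ½, so this error is `half^ (suc m)`.
    (within-≤ (ℚ.≤-trans (half^-antitone (ℕ.n≤1+n m)) (half^-antitone N≤m))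
      (riemann-within k 1≤3/2 (recip-geometric m)))
    (within-≤ (ℚ.≤-trans (*-monoˡ-≤ (0≤half^ k) 1-half^≤1)
      (ℚ.≤-trans (ℚ.≤-reflexive (ℚ.*-identityˡ (half^ k))) (half^-antitone N≤k)))
      (riemann-geometric-within m k)))
  where
  1-half^≤1 : 1ℚ - half^ m ≤ 1ℚ
  1-half^≤1 = ≤-from-difference (half^ m) (solve 1 (λ h → con 1ℚ :- h :+ h := con 1ℚ) refl
      (half^ m)) (0≤half^ m)

log-coefficient-hasSum : log-coefficient HasSum log (+ 3 / 2)
-- The threshold is `suc N` because m + 1 coefficients correspond to m geometric terms.
log-coefficient-hasSum ε 0<ε = suc N , λ { (suc m) n (s≤s N≤m) N<n → converge m n N≤m (ℕ.<⇒≤ N<n) }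
  where
  N = proj₁ (vanishing (1ℚ + 1ℚ) ε 0<ε)
  small = proj₂ (vanishing (1ℚ + 1ℚ) ε 0<ε)
  converge : ∀ m n → N ℕ.≤ m → N ℕ.≤ n →
    ℚ.∣ (∑[ j < suc m ] log-coefficient (toℕ j)) - riemann recip n 1ℚ 3/2 ∣ < ε
  converge m n N≤m N≤n = let upper , lower = log-within N≤m N≤n in
      ℚ.≤-<-trans (subst (λ s → ℚ.∣ s - R ∣ ≤ (1ℚ + 1ℚ) * half^ N)
        (sym (sum≡partial log-coefficient (suc m)))
    (∣-∣-bound {S} {R} (subst (_≤ (1ℚ + 1ℚ) * half^ N)
      (solve 2 (λ r s → :- (r :- s) := s :- r) refl R S) lower) upper)) small
    where
    R = riemann recip n 1ℚ 3/2
    S = partial log-coefficient (suc m)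

-- The coefficient of X₁₀

ϑ-series-0 : ∀ j → ϑ-series 0 j ≡ oneₛ j
ϑ-series-0 zero    = refl
ϑ-series-0 (suc j) = trans (cong (λ k → fromℕ k * weight 0)
  (indicator-no (ν₂[ 0 C 0 ]≡? suc j) λ (2ʲ⁺¹∣1 , _) → 2^≢1 (ℕ.∣1⇒≡1 2ʲ⁺¹∣1)))
  (ℚ.*-zeroˡ (weight 0))
  where
  2^≢1 : 2 ℕ.^ suc j ≢ 1
  2^≢1 eq = ℕ.<⇒≢ (ℕ.≤-trans (s≤s (s≤s z≤n)) (ℕ.*-monoʳ-≤ 2 (ℕ.m^n>0 2 j))) (sym eq)

maximum : (ℕ → ℕ) → ℕ → ℕ
maximum f zero    = f 0
maximum f (suc j) = maximum f j ℕ.⊔ f (suc j)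

≤maximum : ∀ f {i j} → i ℕ.≤ j → f i ℕ.≤ maximum f j
≤maximum f {j = zero}  z≤n = ℕ.≤-refl
≤maximum f {i} {suc j} i≤1+j with ℕ.m≤n⇒m<n∨m≡n i≤1+j
... | inj₁ (s≤s i≤j) = ℕ.≤-trans (≤maximum f i≤j) (ℕ.m≤m⊔n (maximum f j) (f (suc j)))
... | inj₂ refl      = ℕ.m≤n⊔m (maximum f j) (f (suc j))

counts-scaled : ∀ n t k w → occurrences n (value w) ≡ t ℕ.* k → counts n w ≡ fromℕ t * fromℕ k
counts-scaled n t k w eq = trans (/1≡fromℕ (occurrences n (value w)))
  (trans (cong fromℕ eq) (fromℕ-homo-* t k))

module _ (P : ℕ → Polynomial) (ϑ≡P : ∀ j n → ϑ₂-ratio j n ≡ eval (P j) (counts n)) where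

  module _ (j : ℕ) where

    -- Larger than `j`, so that congruence modulo xᴸ reaches coefficient `j`; and at least as long
    -- as every word in P 0, ..., P j, since multiplying by (1 + x/2)ᵗ involves all of these.
    L : ℕ
    L = suc j ℕ.⊔ maximum (λ i → maxLength (P i)) j

    direction : W → ℚ
    direction w = fromℕ (occurrences (block L 0) (value w))

    -- Along a line through the origin `P i` is a polynomial in t. Its constant term is the value at
    -- n = 0, where the series is 1.
    ϑ-series-jet : ∀ i → i ℕ.≤ j → ∀ v (n : ℕ → ℕ) → n 0 ≡ 0 →
      (∀ t w → length (value w) ℕ.≤ L → counts (n t) w ≡ fromℕ t * v w) →
      Jet (λ t → ϑ-series (n t) i) (oneₛ i) (linear v (P i))
    ϑ-series-jet i i≤j v n n₀≡0 counts≡ = subst (λ c → Jet _ c (linear v (P i))) constant≡ jet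
      where
      jet : Jet (λ t → ϑ-series (n t) i) (constant (P i)) (linear v (P i))
      jet = jet-cong (λ t → trans
        (sym (eval-cong L (counts≡ t) (P i)
          (ℕ.≤-trans (≤maximum (λ i → maxLength (P i)) i≤j)
            (ℕ.m≤n⊔m (suc j) (maximum (λ i → maxLength (P i)) j)))))
        (trans (sym (ϑ≡P i (n t))) (ϑ₂-ratio≡ϑ-series i (n t)))) (jet-eval v (P i))
      constant≡ : constant (P i) ≡ oneₛ i
      constant≡ = trans (sym (jet-value jet))
        (trans (cong (λ m → ϑ-series m i) n₀≡0) (ϑ-series-0 i))

    -- Both jets describe the same function of t. By the Leibniz rule the product has the derivative
    -- along `direction` plus the logarithm coefficient; on the other side `basis word10`
    -- contributes the wanted coefficient.
    coefficient-X10 : coefficient (X word10) (P j) ≡ log-coefficient j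
    coefficient-X10 = ∙-cancelˡ (linear direction (P j)) _ _ (begin
      linear direction (P j) + coefficient (X word10) (P j)
        ≡⟨ cong (_+_ (linear direction (P j))) (coefficient-X word10 (P j)) ⟩
      linear direction (P j) + linear (basis word10) (P j)
        ≡⟨ linear-+ direction (basis word10) (P j) ⟨
      linear (λ w → direction w + basis word10 w) (P j)
        ≡⟨ jet-unique blocks10-jet convolved ⟩
      conv oneₛ (λ i → linear direction (P i)) j + conv log-coefficient oneₛ j
        ≡⟨ cong₂ _+_ (conv-oneˡ (λ i → linear direction (P i)) j) (conv-oneʳ log-coefficient j) ⟩
      linear direction (P j) + log-coefficient j ∎)
      where
      open ≡-Reasoning
      blocks10-jet : Jet (λ t → ϑ-series (blocks10 L t) j) (oneₛ j)
        (linear (λ w → direction w + basis word10 w) (P j))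
      blocks10-jet = ϑ-series-jet j ℕ.≤-refl _ (blocks10 L) refl λ t w ∣w∣≤L →
        trans (counts-scaled (blocks10 L t) t
          (occurrences (block L 0) (value w) ℕ.+ indicator (w ≟ᵂ word10)) w
            (occurrences-blocks10 L t w ∣w∣≤L))
          (cong (fromℕ t *_) (fromℕ-homo-+ (occurrences (block L 0) (value w))
            (indicator (w ≟ᵂ word10))))
      convolved : Jet (λ t → ϑ-series (blocks10 L t) j) (conv oneₛ oneₛ j)
        (conv oneₛ (λ i → linear direction (P i)) j + conv log-coefficient oneₛ j)
      convolved = jet-cong
        (λ t → sym (trans (ϑ-series-blocks10 L t j
          (ℕ.m≤m⊔n (suc j) (maximum (λ i → maxLength (P i)) j)))
            (iterate-β-conv t (ϑ-series (blocks L t)) j)))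
        (jet-conv j jet-binomial λ i i≤j → ϑ-series-jet i i≤j direction (blocks L) refl
          λ t w ∣w∣≤L → counts-scaled (blocks L t) t (occurrences (block L 0) (value w)) w
            (occurrences-blocks L t w ∣w∣≤L))

HasSum-cong : ∀ {a b r} → (∀ j → a j ≡ b j) → a HasSum r → b HasSum r
HasSum-cong {r = r} a≡b a-sum ε 0<ε = proj₁ (a-sum ε 0<ε) , λ m n N≤m N≤n →
  subst (λ s → ℚ.∣ s - approx r n ∣ < ε) (sum-cong-≗ {m} (λ j → a≡b (toℕ j)))
      (proj₂ (a-sum ε 0<ε) m n N≤m N≤n)

corollary2p4 : (P : ℕ → Polynomial) →
    (∀ j n → ϑ₂-ratio j n ≡ eval (P j) (counts n)) →
    (∀ j → coefficient (X word10) (P j) ≡ [x^ j ] log1+ x/2 refl) ×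
    ((λ j → coefficient (X word10) (P j)) HasSum log (+ 3 / 2))
corollary2p4 P ϑ≡P =
  (λ j → trans (coefficient-X10 P ϑ≡P j) (sym (log1+x/2 j))) ,
  HasSum-cong {r = log (+ 3 / 2)} (λ j → sym (coefficient-X10 P ϑ≡P j)) log-coefficient-hasSum
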